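{- Let $P$ be a bounded and graded poset. Then \[\underline{H}_P(t)=G_{\sigma(P)}(t)=G_{\tau(P^*)}(t).\]
   Context: All posets are finite, bounded (least element $\widehat 0$, greatest element $\widehat 1$) and graded with rank function $\rho$, $\rho(\widehat 0)=0$; $\rho(P):=\rho(\widehat 1)$. Atoms are elements of rank $1$, coatoms elements of rank $\rho(P)-1$. The truncation $\tau(P)$ is $P$ with all coatoms removed; the dual truncation $\sigma(P)$ is $P$ with all atoms removed. The dual $P^*$ has the same elements with $x\le^* y$ iff $y\le x$ in $P$. Chow polynomial: let $\mu$ be the Möbius function of $P$. For $x\le y$ put $\chi_{[x,y]}(t)=\sum_{x\le z\le y}\mu(x,z)t^{\rho(y)-\rho(z)}$, and define $\overline{\chi}_{[x,x]}(t)=-1$ and $\overline{\chi}_{[x,y]}(t)=\chi_{[x,y]}(t)/(t-1)$ for $x<y$. Define $\underline{H}_{[x,x]}(t)=1$ and, for $x<y$, $\underline{H}_{[x,y]}(t)=\sum_{x<z\le y}\overline{\chi}_{[x,z]}(t)\,\underline{H}_{[z,y]}(t)$. The Chow polynomial is $\underline{H}_P(t):=\underline{H}_{[\widehat0,\widehat1]}(t)$. The (left) augmented Chow polynomial is $G_P(t):=\sum_{z\in P}t^{\rho(z)}\underline{H}_{[z,\widehat1]}(t)$. -}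

module Defs where

open import Data.Bool using (T?; Bool; true; false; if_then_else_; not; _∧_)
open import Data.Nat as ℕ using (ℕ; zero; suc; _∸_)
open import Data.Integer as ℤ using (ℤ; +_; -_)
open import Data.List using (List; []; _∷_; filter; length; foldr; map; replicate)
open import Data.List.Membership.Propositional using (_∈_)
open import Data.List.Relation.Unary.Unique.Propositional using (Unique)
open import Data.Product using (_×_; _,_)
open import Data.Sum using (_⊎_)
open import Relation.Nullary using (¬_; Dec; does; yes; no)
open import Relation.Binary using (Decidable; IsPartialOrder; Rel)
open import Relation.Binary.PropositionalEquality using (_≡_; _≢_)

-- Polynomials with integer coefficients: coefficient lists, lowest
-- degree first.  Equality of polynomials is coefficientwise (so trailing
-- zeros are irrelevant).

Poly : Set
Poly = List ℤ

coeff : Poly → ℕ → ℤ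
coeff []       _       = + 0
coeff (a ∷ p)  zero    = a
coeff (a ∷ p)  (suc k) = coeff p k

infix 4 _≈ₚ_
_≈ₚ_ : Poly → Poly → Set
p ≈ₚ q = ∀ k → coeff p k ≡ coeff q k

infixl 6 _+ₚ_
_+ₚ_ : Poly → Poly → Poly
[]      +ₚ q       = q
(a ∷ p) +ₚ []      = a ∷ p
(a ∷ p) +ₚ (b ∷ q) = (a ℤ.+ b) ∷ (p +ₚ q)

scale : ℤ → Poly → Poly
scale c = map (c ℤ.*_)

infixl 7 _*ₚ_
_*ₚ_ : Poly → Poly → Poly
[]      *ₚ q = []
(a ∷ p) *ₚ q = scale a q +ₚ (+ 0 ∷ (p *ₚ q))

constP : ℤ → Poly
constP c = c ∷ []

tpow : ℕ → Poly
tpow k = replicate k (+ 0) ++ₗ (+ 1 ∷ [])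
  where
  _++ₗ_ : List ℤ → List ℤ → List ℤ
  []      ++ₗ ys = ys
  (x ∷ xs) ++ₗ ys = x ∷ (xs ++ₗ ys)

-- Quotient of p by (t - 1) (synthetic division).  If
-- p = p₀ + p₁ t + … + p_d t^d then the quotient has coefficients
-- q_k = -(p₀ + … + p_k) for k < d; this is exact whenever p(1) = 0,
-- which is the only situation in which it is used below.
divT-1 : Poly → Poly
divT-1 p = go (+ 0) p
  where
  go : ℤ → Poly → Poly
  go s []          = []
  go s (a ∷ [])    = []
  go s (a ∷ b ∷ r) = (- (s ℤ.+ a)) ∷ go (s ℤ.+ a) (b ∷ r)

sumP : List Poly → Poly
sumP = foldr _+ₚ_ []

sumℤ : List ℤ → ℤ
sumℤ = foldr ℤ._+_ (+ 0)

-- Finite ranked posets (data only; the axioms are in IsBoundedGraded).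
-- The elements of the poset are those listed in `elems`; `bot`/`top`
-- are its least/greatest elements and ρ its rank function.

record RankedPoset : Set₁ where
  field
    Carrier : Set
    elems   : List Carrier
    _≤_     : Rel Carrier _
    _≤?_    : Decidable _≤_
    ρ       : Carrier → ℕ
    bot     : Carrier
    top     : Carrier

  lt? : Carrier → Carrier → Bool
  lt? x y = does (x ≤? y) ∧ not (does (y ≤? x))

  le? : Carrier → Carrier → Bool
  le? x y = does (x ≤? y)

  -- covering relation x ⋖ y (all elements of Carrier are poset elements)
  _⋖_ : Carrier → Carrier → Set
  x ⋖ y = x ≤ y × ¬ (y ≤ x) × (∀ z → x ≤ z → z ≤ y → (z ≤ x) ⊎ (y ≤ z))

module RP = RankedPoset



record IsBoundedGraded (P : RankedPoset) : Set where
  open RankedPoset P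
  field
    complete  : ∀ x → x ∈ elems
    unique    : Unique elems
    isPO      : IsPartialOrder _≡_ _≤_
    bot-least : ∀ x → bot ≤ x
    top-great : ∀ x → x ≤ top
    ρ-bot     : ρ bot ≡ 0
    ρ-cover   : ∀ x y → x ⋖ y → ρ y ≡ suc (ρ x)

-- Möbius function, characteristic polynomials, Chow polynomials.
-- Recursions are bounded by a fuel parameter; fuel = |P| is always
-- sufficient for a genuine poset (strict chains have ≤ |P| elements).

module _ (P : RankedPoset) where
  open RankedPoset P renaming (ρ to rk)

  fuel : ℕ
  fuel = length elems

  möbiusF : ℕ → Carrier → Carrier → ℤ
  möbiusF zero    x y = + 0
  möbiusF (suc n) x y with does (x ≤? y) | does (y ≤? x)
  ... | true  | true  = + 1
  ... | true  | false =
        - sumℤ (map (möbiusF n x) (filter (λ z → x ≤? z) (filter (λ z → T? (lt? z y)) elems)))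
  ... | false | _     = + 0

  möbius : Carrier → Carrier → ℤ
  möbius = möbiusF fuel

  charPoly : Carrier → Carrier → Poly
  charPoly x y =
    sumP (map (λ z → scale (möbius x z) (tpow (rk y ∸ rk z)))
              (filter (λ z → x ≤? z) (filter (λ z → z ≤? y) elems)))

  charPolyBar : Carrier → Carrier → Poly
  charPolyBar x y = if le? y x then constP (- (+ 1)) else divT-1 (charPoly x y)

  chowF : ℕ → Carrier → Carrier → Poly
  chowF zero    x y = []
  chowF (suc n) x y =
    if le? y x then constP (+ 1)
    else sumP (map (λ z → charPolyBar x z *ₚ chowF n z y)
                   (filter (λ z → T? (lt? x z)) (filter (λ z → z ≤? y) elems)))

  chowInterval : Carrier → Carrier → Poly
  chowInterval = chowF fuel

  chow : Poly
  chow = chowInterval bot top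

  augChow : Poly
  augChow = sumP (map (λ z → tpow (rk z) *ₚ chowInterval z top) elems)

isAtom : (P : RankedPoset) → RP.Carrier P → Bool
isAtom P x = RP.ρ P x ℕ.≡ᵇ 1

isCoatom : (P : RankedPoset) → RP.Carrier P → Bool
isCoatom P x = suc (RP.ρ P x) ℕ.≡ᵇ RP.ρ P (RP.top P)

dual : RankedPoset → RankedPoset
dual P = record
  { Carrier = RP.Carrier P
  ; elems   = RP.elems P
  ; _≤_     = λ x y → RP._≤_ P y x
  ; _≤?_    = λ x y → RP._≤?_ P y x
  ; ρ       = λ x → RP.ρ P (RP.top P) ∸ RP.ρ P x
  ; bot     = RP.top P
  ; top     = RP.bot P
  }

-- σ(P): remove all atoms.  Rank in σ(P) is ρ(x) - 1 for x ≠ 0̂ (and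
-- 0 for 0̂, since ρ(0̂) - 1 = 0 in ℕ).  In the degenerate case ρ(P) = 1
-- the top 1̂ is itself an atom; then σ(P) = {0̂} and its top is 0̂.
σ : RankedPoset → RankedPoset
σ P = record
  { Carrier = RP.Carrier P
  ; elems   = filter (λ x → T? (not (isAtom P x))) (RP.elems P)
  ; _≤_     = RP._≤_ P
  ; _≤?_    = RP._≤?_ P
  ; ρ       = λ x → RP.ρ P x ∸ 1
  ; bot     = RP.bot P
  ; top     = if isAtom P (RP.top P) then RP.bot P else RP.top P
  }

-- τ(P): remove all coatoms.  Rank unchanged except ρ(1̂) decreases by 1.
-- In the degenerate case ρ(P) = 1 the bottom 0̂ is a coatom; then
-- τ(P) = {1̂} and its bottom is 1̂.
τ : RankedPoset → RankedPoset
τ P = record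
  { Carrier = RP.Carrier P
  ; elems   = filter (λ x → T? (not (isCoatom P x))) (RP.elems P)
  ; _≤_     = RP._≤_ P
  ; _≤?_    = RP._≤?_ P
  ; ρ       = λ x → if RP.ρ P x ℕ.≡ᵇ RP.ρ P (RP.top P) then RP.ρ P x ∸ 1 else RP.ρ P x
  ; bot     = if isCoatom P (RP.bot P) then RP.top P else RP.bot P
  ; top     = RP.top P
  }

{-# OPTIONS --safe #-}

-- Write T(x, z) = t^(ρ(z) - ρ(x)), ζ(x, z) = 1 for x ≤ z and B = T - t ζ.  As
-- matrices (t - 1) χ̄ = μ T - t δ = μ B and χ̄ H = - δ, so the vector
-- h(x) = H_[x,1̂] satisfies B h = (1 - t) 𝟙.  This relation determines h and no
-- longer involves μ.
--
-- Let Q = σ(P).  Above any x ≠ 0̂ the posets P and Q agree, hence so do their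
-- vectors h; comparing the relations of P and of Q at 0̂ gives
-- (1 - t) H_P = (1 - t) G_Q.
--
-- The relation at 0̂ also says G_Q = (1 - t) + t ∑ h.  Up to a shift of ranks τ(P*)
-- is Q*, whose vector h* satisfies h* B = (1 - t) 𝟙.  Evaluating h* B h in two ways
-- gives ∑ h = ∑ h*, so that G_Q = G_{Q*}.

module Submission where

open import Defs
open import Algebra.Bundles using (CommutativeRing)
import Algebra.Properties.CommutativeSemigroup as CommutativeSemigroupProperties
import Algebra.Properties.Ring as RingProperties
import Algebra.Solver.Ring as RingSolver
open import Algebra.Solver.Ring.AlmostCommutativeRing using (fromCommutativeRing; _-Raw-AlmostCommutative⟶_)
open import Data.Bool using (Bool; true; false; if_then_else_; not; T; T?)
open import Data.Integer as ℤ using (ℤ; +_; -_)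
import Data.Integer.Properties as ℤₚ
import Data.Integer.Solver as ℤSolver
open import Data.List using (List; []; _∷_; filter; foldr; length; map)
open import Data.List.Membership.Propositional using (_∈_; find; lose)
open import Data.List.Membership.Propositional.Properties using (∈-filter⁺; ∈-filter⁻; ∈-length)
open import Data.List.Properties using (filter-≐; length-filter)
import Data.List.Relation.Unary.All as All
open import Data.List.Relation.Unary.AllPairs using (_∷_)
open import Data.List.Relation.Unary.Any using (any?; here; there)
open import Data.List.Relation.Unary.Unique.Propositional using (Unique)
import Data.List.Relation.Unary.Unique.Propositional.Properties as Uniqueₚ
open import Data.Maybe using (Maybe; just; nothing)
open import Data.Nat as ℕ using (ℕ; zero; suc; _∸_; _≡ᵇ_; s≤s; z≤n)
import Data.Nat.Properties as ℕₚ
open import Data.Product using (_×_; _,_; proj₁; proj₂)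
open import Data.Sum using (_⊎_; inj₁; inj₂)
open import Level using (0ℓ)
open import Relation.Binary using (IsPartialOrder)
import Relation.Binary.Construct.Flip.EqAndOrd as Flip
open import Relation.Binary.PropositionalEquality using (_≡_; _≢_; refl; sym; trans; cong; cong₂; subst; module ≡-Reasoning)
import Relation.Binary.Reasoning.Setoid as SetoidReasoning
open import Relation.Nullary using (¬_; Dec; does; yes; no; contradiction)
open import Relation.Nullary.Decidable using (_×-dec_; ¬?)
open import Relation.Unary using (Decidable; Pred)

-- Polynomials

-- The kernel `B` is forced by the convention χ̄(x,x) = -1. For x < y one has (t - 1) χ̄ = χ, but on
-- the diagonal (t - 1) χ̄ = 1 - t while χ = 1. This is the origin of the correction by t δ, and
-- writing δ = μ ζ turns the whole expression into a left multiple of μ. The vector δ(·, 1̂) is μ 𝟙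
-- as well, so the invertible μ cancels from the relation.
--
-- Removing μ is what makes duality usable. Reversing the order replaces χ = μ T by the transpose of
-- T μ, so in general χ̄ of the dual is not the transpose of χ̄, and the two Chow recursions have no
-- direct relation. T and ζ, and hence `B`, are merely transposed: a single matrix serves both
-- posets, with h as a column vector and h* as a row vector.

-- _≈ₚ_ unfolds to a function type from which Agda cannot recover the two
-- polynomials; the record makes them inferable.
infix 4 _≋_
record _≋_ (p q : Poly) : Set where
  constructor mk≋
  field coeffs : p ≈ₚ q
open _≋_

negP : Poly → Poly
negP = map -_

1ₚ t : Poly
1ₚ = constP (+ 1)
t  = tpow 1

-- Coefficients and the commutative ring laws

coeff-+ : ∀ p q k → coeff (p +ₚ q) k ≡ coeff p k ℤ.+ coeff q k
coeff-+ []      q       k       = sym (ℤₚ.+-identityˡ _)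
coeff-+ (a ∷ p) []      k       = sym (ℤₚ.+-identityʳ _)
coeff-+ (a ∷ p) (b ∷ q) zero    = refl
coeff-+ (a ∷ p) (b ∷ q) (suc k) = coeff-+ p q k

coeff-scale : ∀ c p k → coeff (scale c p) k ≡ c ℤ.* coeff p k
coeff-scale c []      k       = sym (ℤₚ.*-zeroʳ c)
coeff-scale c (a ∷ p) zero    = refl
coeff-scale c (a ∷ p) (suc k) = coeff-scale c p k

coeff-neg : ∀ p k → coeff (negP p) k ≡ - coeff p k
coeff-neg []      k       = refl
coeff-neg (a ∷ p) zero    = refl
coeff-neg (a ∷ p) (suc k) = coeff-neg p k

coeff-*-zero : ∀ a p q → coeff ((a ∷ p) *ₚ q) 0 ≡ a ℤ.* coeff q 0
coeff-*-zero a p q = trans (coeff-+ (scale a q) _ 0)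
  (trans (ℤₚ.+-identityʳ _) (coeff-scale a q 0))

coeff-*-suc : ∀ a p q k →
  coeff ((a ∷ p) *ₚ q) (suc k) ≡ a ℤ.* coeff q (suc k) ℤ.+ coeff (p *ₚ q) k
coeff-*-suc a p q k = trans (coeff-+ (scale a q) _ (suc k))
  (cong (ℤ._+ _) (coeff-scale a q (suc k)))

≋-refl : ∀ {p} → p ≋ p
≋-refl = mk≋ λ _ → refl

≋-sym : ∀ {p q} → p ≋ q → q ≋ p
≋-sym e = mk≋ λ k → sym (coeffs e k)

≋-trans : ∀ {p q r} → p ≋ q → q ≋ r → p ≋ r
≋-trans e f = mk≋ λ k → trans (coeffs e k) (coeffs f k)

+ₚ-cong : ∀ {p p′ q q′} → p ≋ p′ → q ≋ q′ → p +ₚ q ≋ p′ +ₚ q′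
+ₚ-cong {p} {p′} {q} {q′} e f = mk≋ λ k → trans (coeff-+ p q k)
  (trans (cong₂ ℤ._+_ (coeffs e k) (coeffs f k)) (sym (coeff-+ p′ q′ k)))

+ₚ-congˡ : ∀ p {q q′} → q ≋ q′ → p +ₚ q ≋ p +ₚ q′
+ₚ-congˡ p e = +ₚ-cong {p} ≋-refl e

+ₚ-assoc : ∀ p q r → (p +ₚ q) +ₚ r ≋ p +ₚ (q +ₚ r)
+ₚ-assoc p q r = mk≋ λ k → begin
  coeff ((p +ₚ q) +ₚ r) k                      ≡⟨ coeff-+ (p +ₚ q) r k ⟩
  coeff (p +ₚ q) k ℤ.+ coeff r k               ≡⟨ cong (ℤ._+ _) (coeff-+ p q k) ⟩
  (coeff p k ℤ.+ coeff q k) ℤ.+ coeff r k      ≡⟨ ℤₚ.+-assoc (coeff p k) _ _ ⟩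
  coeff p k ℤ.+ (coeff q k ℤ.+ coeff r k)      ≡⟨ cong (λ u → coeff p k ℤ.+ u) (coeff-+ q r k) ⟨
  coeff p k ℤ.+ coeff (q +ₚ r) k               ≡⟨ coeff-+ p (q +ₚ r) k ⟨
  coeff (p +ₚ (q +ₚ r)) k                      ∎
  where open ≡-Reasoning

+ₚ-comm : ∀ p q → p +ₚ q ≋ q +ₚ p
+ₚ-comm p q = mk≋ λ k → trans (coeff-+ p q k)
  (trans (ℤₚ.+-comm (coeff p k) _) (sym (coeff-+ q p k)))

+ₚ-identityʳ : ∀ p → p +ₚ [] ≋ p
+ₚ-identityʳ p = mk≋ λ k → trans (coeff-+ p [] k) (ℤₚ.+-identityʳ _)

negP-inverseʳ : ∀ p → p +ₚ negP p ≋ []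
negP-inverseʳ p = mk≋ λ k → trans (coeff-+ p (negP p) k)
  (trans (cong (λ u → coeff p k ℤ.+ u) (coeff-neg p k)) (ℤₚ.+-inverseʳ (coeff p k)))

negP-cong : ∀ {p q} → p ≋ q → negP p ≋ negP q
negP-cong {p} {q} e = mk≋ λ k →
  trans (coeff-neg p k) (trans (cong -_ (coeffs e k)) (sym (coeff-neg q k)))

*ₚ-zeroʳ : ∀ p → p *ₚ [] ≋ []
*ₚ-zeroʳ []      = ≋-refl
*ₚ-zeroʳ (a ∷ p) = mk≋ λ
  { zero    → refl
  ; (suc k) → coeffs (*ₚ-zeroʳ p) k }

*ₚ-congˡ : ∀ p {q q′} → q ≋ q′ → p *ₚ q ≋ p *ₚ q′
*ₚ-congˡ []      e = ≋-refl
*ₚ-congˡ (a ∷ p) {q} {q′} e = mk≋ λ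
  { zero    → trans (coeff-*-zero a p q)
      (trans (cong (a ℤ.*_) (coeffs e 0)) (sym (coeff-*-zero a p q′)))
  ; (suc k) → trans (coeff-*-suc a p q k)
      (trans (cong₂ (λ u v → a ℤ.* u ℤ.+ v) (coeffs e (suc k)) (coeffs (*ₚ-congˡ p e) k))
             (sym (coeff-*-suc a p q′ k))) }

-- Multiplication recurses on its left factor; this mirrored recursion on the right factor is what
-- the induction for commutativity runs on.
*ₚ-∷ : ∀ p b q → p *ₚ (b ∷ q) ≋ scale b p +ₚ (+ 0 ∷ (p *ₚ q))
*ₚ-∷ []      b q = mk≋ λ { zero → refl ; (suc k) → refl }
*ₚ-∷ (a ∷ p) b q = mk≋ λ
  { zero    → cong (ℤ._+ + 0) (ℤₚ.*-comm a b)
  ; (suc k) → begin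
      coeff ((a ∷ p) *ₚ (b ∷ q)) (suc k)
        ≡⟨ coeff-*-suc a p (b ∷ q) k ⟩
      a ℤ.* coeff q k ℤ.+ coeff (p *ₚ (b ∷ q)) k
        ≡⟨ cong (λ u → a ℤ.* coeff q k ℤ.+ u) (coeffs (*ₚ-∷ p b q) k) ⟩
      a ℤ.* coeff q k ℤ.+ coeff (scale b p +ₚ (+ 0 ∷ (p *ₚ q))) k
        ≡⟨ cong (λ u → a ℤ.* coeff q k ℤ.+ u) (coeff-+ (scale b p) _ k) ⟩
      a ℤ.* coeff q k ℤ.+ (coeff (scale b p) k ℤ.+ coeff (+ 0 ∷ (p *ₚ q)) k)
        ≡⟨ solve 3 (λ x y z → x :+ (y :+ z) := y :+ (x :+ z)) refl (a ℤ.* coeff q k) (coeff (scale b p) k) _ ⟩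
      coeff (scale b p) k ℤ.+ (a ℤ.* coeff q k ℤ.+ coeff (+ 0 ∷ (p *ₚ q)) k)
        ≡⟨ cong (λ u → coeff (scale b p) k ℤ.+ (u ℤ.+ coeff (+ 0 ∷ (p *ₚ q)) k)) (coeff-scale a q k) ⟨
      coeff (scale b p) k ℤ.+ (coeff (scale a q) k ℤ.+ coeff (+ 0 ∷ (p *ₚ q)) k)
        ≡⟨ cong (λ u → coeff (scale b p) k ℤ.+ u) (coeff-+ (scale a q) _ k) ⟨
      coeff (scale b p) k ℤ.+ coeff ((a ∷ p) *ₚ q) k
        ≡⟨ coeff-+ (scale b p) _ k ⟨
      coeff (scale b p +ₚ ((a ∷ p) *ₚ q)) k ∎ }
  where
  open ≡-Reasoning
  open ℤSolver.+-*-Solver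

∷-cong : ∀ {a p q} → p ≋ q → a ∷ p ≋ a ∷ q
∷-cong e = mk≋ λ { zero → refl ; (suc k) → coeffs e k }

*ₚ-comm : ∀ p q → p *ₚ q ≋ q *ₚ p
*ₚ-comm []      q = ≋-sym (*ₚ-zeroʳ q)
*ₚ-comm (a ∷ p) q = ≋-trans (+ₚ-cong ≋-refl (∷-cong (*ₚ-comm p q))) (≋-sym (*ₚ-∷ q a p))

*ₚ-congʳ : ∀ q {p p′} → p ≋ p′ → p *ₚ q ≋ p′ *ₚ q
*ₚ-congʳ q {p} {p′} e = ≋-trans (*ₚ-comm p q) (≋-trans (*ₚ-congˡ q e) (*ₚ-comm q p′))

*ₚ-distribˡ-+ₚ : ∀ p q r → p *ₚ (q +ₚ r) ≋ p *ₚ q +ₚ p *ₚ r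
*ₚ-distribˡ-+ₚ []      q r = ≋-refl
*ₚ-distribˡ-+ₚ (a ∷ p) q r = mk≋ λ
  { zero    → begin
      coeff ((a ∷ p) *ₚ (q +ₚ r)) 0              ≡⟨ coeff-*-zero a p (q +ₚ r) ⟩
      a ℤ.* coeff (q +ₚ r) 0                     ≡⟨ cong (a ℤ.*_) (coeff-+ q r 0) ⟩
      a ℤ.* (coeff q 0 ℤ.+ coeff r 0)            ≡⟨ ℤₚ.*-distribˡ-+ a (coeff q 0) _ ⟩
      a ℤ.* coeff q 0 ℤ.+ a ℤ.* coeff r 0        ≡⟨ cong₂ ℤ._+_ (coeff-*-zero a p q) (coeff-*-zero a p r) ⟨
      coeff ((a ∷ p) *ₚ q) 0 ℤ.+ coeff ((a ∷ p) *ₚ r) 0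
                                                 ≡⟨ coeff-+ ((a ∷ p) *ₚ q) _ 0 ⟨
      coeff ((a ∷ p) *ₚ q +ₚ (a ∷ p) *ₚ r) 0     ∎
  ; (suc k) → begin
      coeff ((a ∷ p) *ₚ (q +ₚ r)) (suc k)
        ≡⟨ coeff-*-suc a p (q +ₚ r) k ⟩
      a ℤ.* coeff (q +ₚ r) (suc k) ℤ.+ coeff (p *ₚ (q +ₚ r)) k
        ≡⟨ cong₂ (λ u v → a ℤ.* u ℤ.+ v) (coeff-+ q r (suc k))
             (trans (coeffs (*ₚ-distribˡ-+ₚ p q r) k) (coeff-+ (p *ₚ q) _ k)) ⟩
      a ℤ.* (coeff q (suc k) ℤ.+ coeff r (suc k)) ℤ.+ (coeff (p *ₚ q) k ℤ.+ coeff (p *ₚ r) k)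
        ≡⟨ solve 5 (λ x y z u v → x :* (y :+ z) :+ (u :+ v) := (x :* y :+ u) :+ (x :* z :+ v))
             refl a (coeff q (suc k)) _ _ _ ⟩
      (a ℤ.* coeff q (suc k) ℤ.+ coeff (p *ₚ q) k) ℤ.+ (a ℤ.* coeff r (suc k) ℤ.+ coeff (p *ₚ r) k)
        ≡⟨ cong₂ ℤ._+_ (coeff-*-suc a p q k) (coeff-*-suc a p r k) ⟨
      coeff ((a ∷ p) *ₚ q) (suc k) ℤ.+ coeff ((a ∷ p) *ₚ r) (suc k)
        ≡⟨ coeff-+ ((a ∷ p) *ₚ q) _ (suc k) ⟨
      coeff ((a ∷ p) *ₚ q +ₚ (a ∷ p) *ₚ r) (suc k) ∎ }
  where
  open ≡-Reasoning
  open ℤSolver.+-*-Solver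

*ₚ-distribʳ-+ₚ : ∀ p q r → (q +ₚ r) *ₚ p ≋ q *ₚ p +ₚ r *ₚ p
*ₚ-distribʳ-+ₚ p q r = ≋-trans (*ₚ-comm (q +ₚ r) p)
  (≋-trans (*ₚ-distribˡ-+ₚ p q r) (+ₚ-cong (*ₚ-comm p q) (*ₚ-comm p r)))

0∷-* : ∀ p q → (+ 0 ∷ p) *ₚ q ≋ + 0 ∷ (p *ₚ q)
0∷-* p q = mk≋ λ
  { zero    → coeff-*-zero (+ 0) p q
  ; (suc k) → trans (coeff-*-suc (+ 0) p q k) (ℤₚ.+-identityˡ _) }

scale-+ : ∀ c p q → scale c (p +ₚ q) ≋ scale c p +ₚ scale c q
scale-+ c p q = mk≋ λ k → begin
  coeff (scale c (p +ₚ q)) k                     ≡⟨ coeff-scale c (p +ₚ q) k ⟩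
  c ℤ.* coeff (p +ₚ q) k                         ≡⟨ cong (c ℤ.*_) (coeff-+ p q k) ⟩
  c ℤ.* (coeff p k ℤ.+ coeff q k)                ≡⟨ ℤₚ.*-distribˡ-+ c (coeff p k) _ ⟩
  c ℤ.* coeff p k ℤ.+ c ℤ.* coeff q k            ≡⟨ cong₂ ℤ._+_ (coeff-scale c p k) (coeff-scale c q k) ⟨
  coeff (scale c p) k ℤ.+ coeff (scale c q) k    ≡⟨ coeff-+ (scale c p) _ k ⟨
  coeff (scale c p +ₚ scale c q) k               ∎
  where open ≡-Reasoning

scale-scale : ∀ a b p → scale (a ℤ.* b) p ≋ scale a (scale b p)
scale-scale a b p = mk≋ λ k → begin
  coeff (scale (a ℤ.* b) p) k    ≡⟨ coeff-scale (a ℤ.* b) p k ⟩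
  a ℤ.* b ℤ.* coeff p k          ≡⟨ ℤₚ.*-assoc a b _ ⟩
  a ℤ.* (b ℤ.* coeff p k)        ≡⟨ cong (a ℤ.*_) (coeff-scale b p k) ⟨
  a ℤ.* coeff (scale b p) k      ≡⟨ coeff-scale a (scale b p) k ⟨
  coeff (scale a (scale b p)) k  ∎
  where open ≡-Reasoning

scale-* : ∀ c p q → scale c p *ₚ q ≋ scale c (p *ₚ q)
scale-* c []      q = ≋-refl
scale-* c (a ∷ p) q = ≋-trans
  (+ₚ-cong (scale-scale c a q)
    (mk≋ λ { zero → sym (ℤₚ.*-zeroʳ c) ; (suc k) → coeffs (scale-* c p q) k }))
  (≋-sym (scale-+ c (scale a q) _))

*ₚ-assoc : ∀ p q r → (p *ₚ q) *ₚ r ≋ p *ₚ (q *ₚ r)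
*ₚ-assoc []      q r = ≋-refl
*ₚ-assoc (a ∷ p) q r = ≋-trans (*ₚ-distribʳ-+ₚ r (scale a q) _)
  (+ₚ-cong (scale-* a q r) (≋-trans (0∷-* (p *ₚ q) r) (∷-cong (*ₚ-assoc p q r))))

constP0 : constP (+ 0) ≋ []
constP0 = mk≋ λ { zero → refl ; (suc k) → refl }

constP-* : ∀ c p → constP c *ₚ p ≋ scale c p
constP-* c p = mk≋ λ
  { zero    → trans (coeff-*-zero c [] p) (sym (coeff-scale c p 0))
  ; (suc k) → trans (coeff-*-suc c [] p k) (trans (ℤₚ.+-identityʳ _) (sym (coeff-scale c p (suc k)))) }

*ₚ-identityˡ : ∀ p → 1ₚ *ₚ p ≋ p
*ₚ-identityˡ p = ≋-trans (constP-* (+ 1) p)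
  (mk≋ λ k → trans (coeff-scale (+ 1) p k) (ℤₚ.*-identityˡ _))

polyRing : CommutativeRing 0ℓ 0ℓ
polyRing = record
  { Carrier = Poly ; _≈_ = _≋_ ; _+_ = _+ₚ_ ; _*_ = _*ₚ_ ; -_ = negP ; 0# = [] ; 1# = 1ₚ
  ; isCommutativeRing = record
    { isRing = record
      { +-isAbelianGroup = record
        { isGroup = record
          { isMonoid = record
            { isSemigroup = record
              { isMagma = record
                { isEquivalence = record { refl = ≋-refl ; sym = ≋-sym ; trans = ≋-trans }
                ; ∙-cong = +ₚ-cong }
              ; assoc = +ₚ-assoc }
            ; identity = (λ _ → ≋-refl) , +ₚ-identityʳ }
          ; inverse = (λ p → ≋-trans (+ₚ-comm (negP p) p) (negP-inverseʳ p)) , negP-inverseʳ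
          ; ⁻¹-cong = negP-cong }
        ; comm = +ₚ-comm }
      ; *-cong = λ {p} {p′} {q} {q′} e f → ≋-trans (*ₚ-congʳ q e) (*ₚ-congˡ p′ f)
      ; *-assoc = *ₚ-assoc
      ; *-identity = *ₚ-identityˡ , λ p → ≋-trans (*ₚ-comm p 1ₚ) (*ₚ-identityˡ p)
      ; distrib = *ₚ-distribˡ-+ₚ , *ₚ-distribʳ-+ₚ }
    ; *-comm = *ₚ-comm } }

-- With integers as solver coefficients, constants such as 1 and -1 are combined by computation
-- inside polynomial identities.
constP-homo : CommutativeRing.rawRing ℤₚ.+-*-commutativeRing
              -Raw-AlmostCommutative⟶ fromCommutativeRing polyRing
constP-homo = record
  { ⟦_⟧    = constP
  ; +-homo = λ _ _ → ≋-refl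
  ; *-homo = λ a b → ≋-sym (constP-* a (constP b))
  ; -‿homo = λ _ → ≋-refl
  ; 0-homo = constP0
  ; 1-homo = ≋-refl
  }

constP-≟ : ∀ a b → Maybe (constP a ≋ constP b)
constP-≟ a b with a ℤ.≟ b
... | yes refl = just ≋-refl
... | no  _    = nothing

module PolySolver = RingSolver
  (CommutativeRing.rawRing ℤₚ.+-*-commutativeRing) (fromCommutativeRing polyRing) constP-homo constP-≟

open CommutativeRing polyRing using () renaming (reflexive to ≡⇒≋)

constP-cong : ∀ {a b} → a ≡ b → constP a ≋ constP b
constP-cong refl = ≋-refl

constP0-* : ∀ p → constP (+ 0) *ₚ p ≋ []
constP0-* p = *ₚ-congʳ p constP0

∷-horner : ∀ a p → a ∷ p ≋ constP a +ₚ t *ₚ p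
∷-horner a p = ≋-sym (≋-trans
  (+ₚ-congˡ (constP a) (≋-trans (0∷-* 1ₚ p) (∷-cong (*ₚ-identityˡ p))))
  (mk≋ λ { zero → ℤₚ.+-identityʳ a ; (suc k) → refl }))

tpow-suc : ∀ k → tpow (suc k) ≋ t *ₚ tpow k
tpow-suc k = ≋-sym (≋-trans (0∷-* 1ₚ (tpow k)) (∷-cong (*ₚ-identityˡ (tpow k))))

-- Cancellation of 1 - t and division by t - 1

1-t : Poly
1-t = 1ₚ +ₚ negP t

-- Multiplication by 1 - t takes successive differences of coefficients, so the coefficients are
-- recovered one after the other from the constant term.
1-t-cancel : ∀ p q → 1-t *ₚ p ≋ 1-t *ₚ q → p ≋ q
1-t-cancel p q e = mk≋ eq
  where
  coeff₀ : ∀ r → coeff (1-t *ₚ r) 0 ≡ coeff r 0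
  coeff₀ r = trans (coeff-*-zero (+ 1) (constP (- (+ 1))) r) (ℤₚ.*-identityˡ _)

  coeffₛ : ∀ r k → coeff (1-t *ₚ r) (suc k) ≡ coeff r (suc k) ℤ.- coeff r k
  coeffₛ r k = trans (coeff-*-suc (+ 1) (constP (- (+ 1))) r k) (cong₂ ℤ._+_ (ℤₚ.*-identityˡ (coeff r (suc k)))
    (trans (coeffs (constP-* (- (+ 1)) r) k)
      (trans (coeff-scale (- (+ 1)) r k) (ℤₚ.-1*i≡-i (coeff r k)))))

  eq : p ≈ₚ q
  eq zero    = trans (sym (coeff₀ p)) (trans (coeffs e 0) (coeff₀ q))
  eq (suc k) = RingProperties.+-cancelʳ ℤₚ.+-*-ring (- coeff q k) _ _
    (trans (cong (λ u → coeff p (suc k) ℤ.- u) (sym (eq k)))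
      (trans (sym (coeffₛ p k)) (trans (coeffs e (suc k)) (coeffₛ q k))))

-- The meta is solved by the local loop of divT-1, which is not exported.
mutual
  divLoop : ℤ → Poly → Poly
  divLoop = _

  divT-1-loop : ∀ p → divT-1 p ≡ divLoop (+ 0) p
  -- With `+ 0` replaced by a variable, the meta is applied to distinct variables and unification
  -- determines it.
  divT-1-loop p with + 0
  ... | s = refl

-- `s` accumulates the coefficients already read, so `s ℤ.+ sumℤ p` is the value of the whole
-- dividend at t = 1; its vanishing is preserved by each step of the loop.
divLoop-exact : ∀ s p → s ℤ.+ sumℤ p ≡ + 0 → 1-t *ₚ divLoop s p ≋ negP (constP s +ₚ p)
divLoop-exact s [] e rewrite trans (sym (ℤₚ.+-identityʳ s)) e =
  mk≋ λ { zero → refl ; (suc zero) → refl ; (suc (suc k)) → refl }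
-- The loop emits nothing for the last coefficient. Nothing is lost, because `s ℤ.+ a` is zero here.
divLoop-exact s (a ∷ []) e = ≋-trans (*ₚ-zeroʳ 1-t)
  (mk≋ λ { zero → cong -_ (sym (trans (cong (λ u → s ℤ.+ u) (sym (ℤₚ.+-identityʳ a))) e))
         ; (suc k) → refl })
divLoop-exact s (a ∷ p@(b ∷ r)) e = begin
  1-t *ₚ (- (s ℤ.+ a) ∷ q)
    ≈⟨ *ₚ-congˡ 1-t (∷-horner (- (s ℤ.+ a)) q) ⟩
  1-t *ₚ (negP c +ₚ t *ₚ q)
    ≈⟨ solve 3 (λ x y z → (con (+ 1) :- x) :* ((:- y) :+ x :* z)
                 := (:- y) :+ x :* y :+ x :* ((con (+ 1) :- x) :* z)) ≋-refl t c q ⟩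
  negP c +ₚ t *ₚ c +ₚ t *ₚ (1-t *ₚ q)
    ≈⟨ +ₚ-congˡ (negP c +ₚ t *ₚ c) (*ₚ-congˡ t (divLoop-exact (s ℤ.+ a) p (trans (ℤₚ.+-assoc s a _) e))) ⟩
  negP c +ₚ t *ₚ c +ₚ t *ₚ negP (c +ₚ p)
    ≈⟨ solve 4 (λ x y z w → (:- (y :+ w)) :+ x :* (y :+ w) :+ x :* (:- ((y :+ w) :+ z))
                 := :- (y :+ (w :+ x :* z))) ≋-refl t (constP s) p (constP a) ⟩
  negP (constP s +ₚ (constP a +ₚ t *ₚ p))
    ≈⟨ negP-cong (+ₚ-congˡ (constP s) (∷-horner a p)) ⟨
  negP (constP s +ₚ (a ∷ p)) ∎
  where
  open SetoidReasoning (CommutativeRing.setoid polyRing)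
  open PolySolver
  c q : Poly
  c = constP (s ℤ.+ a)
  q = divLoop (s ℤ.+ a) p

divT-1-exact : ∀ p → sumℤ p ≡ + 0 → 1-t *ₚ divT-1 p ≋ negP p
divT-1-exact p e rewrite divT-1-loop p =
  ≋-trans (divLoop-exact (+ 0) p (trans (ℤₚ.+-identityˡ _) e))
          (negP-cong (+ₚ-cong constP0 ≋-refl))

-- Values at t = 1

sumℤ-+ₚ : ∀ p q → sumℤ (p +ₚ q) ≡ sumℤ p ℤ.+ sumℤ q
sumℤ-+ₚ []      q       = sym (ℤₚ.+-identityˡ _)
sumℤ-+ₚ (a ∷ p) []      = sym (ℤₚ.+-identityʳ _)
sumℤ-+ₚ (a ∷ p) (b ∷ q) = trans (cong (λ u → (a ℤ.+ b) ℤ.+ u) (sumℤ-+ₚ p q))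
  (solve 4 (λ x y z w → (x :+ y) :+ (z :+ w) := (x :+ z) :+ (y :+ w)) refl a b (sumℤ p) (sumℤ q))
  where open ℤSolver.+-*-Solver

sumℤ-scale-tpow : ∀ c k → sumℤ (scale c (tpow k)) ≡ c
sumℤ-scale-tpow c zero    = trans (ℤₚ.+-identityʳ _) (ℤₚ.*-identityʳ c)
sumℤ-scale-tpow c (suc k) =
  trans (cong (ℤ._+ sumℤ (scale c (tpow k))) (ℤₚ.*-zeroʳ c))
        (trans (ℤₚ.+-identityˡ _) (sumℤ-scale-tpow c k))

sumℤ-sumP : ∀ {A : Set} (f : A → Poly) xs →
  sumℤ (sumP (map f xs)) ≡ sumℤ (map (λ x → sumℤ (f x)) xs)
sumℤ-sumP f []       = refl
sumℤ-sumP f (x ∷ xs) = trans (sumℤ-+ₚ (f x) _) (cong (λ u → sumℤ (f x) ℤ.+ u) (sumℤ-sumP f xs))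

constP-sumℤ : ∀ {A : Set} (f : A → ℤ) xs →
  constP (sumℤ (map f xs)) ≋ sumP (map (λ x → constP (f x)) xs)
constP-sumℤ f []       = constP0
constP-sumℤ f (x ∷ xs) = +ₚ-congˡ (constP (f x)) (constP-sumℤ f xs)

-- Finite sums over lists

module Sum {c ℓ} (R : CommutativeRing c ℓ) where
  open CommutativeRing R renaming (refl to ≈-refl; sym to ≈-sym; trans to ≈-trans)
  open RingProperties ring using (+-cancelˡ; +-cancelʳ)
  open CommutativeSemigroupProperties +-commutativeSemigroup using (interchange)
  open SetoidReasoning setoid

  private variable A B : Set

  ∑ : List A → (A → Carrier) → Carrier
  ∑ xs f = foldr _+_ 0# (map f xs)

  ∑-cong : ∀ (xs : List A) {f g} → (∀ {x} → x ∈ xs → f x ≈ g x) → ∑ xs f ≈ ∑ xs g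
  ∑-cong []       e = ≈-refl
  ∑-cong (x ∷ xs) e = +-cong (e (here refl)) (∑-cong xs (λ m → e (there m)))

  ∑-zero : ∀ (xs : List A) {f} → (∀ {x} → x ∈ xs → f x ≈ 0#) → ∑ xs f ≈ 0#
  ∑-zero []       e = ≈-refl
  ∑-zero (x ∷ xs) e = ≈-trans (+-cong (e (here refl)) (∑-zero xs (λ m → e (there m)))) (+-identityˡ 0#)

  ∑-+ : ∀ (xs : List A) f g → ∑ xs (λ x → f x + g x) ≈ ∑ xs f + ∑ xs g
  ∑-+ []       f g = ≈-sym (+-identityˡ 0#)
  ∑-+ (x ∷ xs) f g = ≈-trans (+-congˡ (∑-+ xs f g)) (interchange (f x) (g x) _ _)

  ∑-*ˡ : ∀ (xs : List A) a f → ∑ xs (λ x → a * f x) ≈ a * ∑ xs f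
  ∑-*ˡ []       a f = ≈-sym (zeroʳ a)
  ∑-*ˡ (x ∷ xs) a f = ≈-trans (+-congˡ (∑-*ˡ xs a f)) (≈-sym (distribˡ a (f x) _))

  ∑-*ʳ : ∀ (xs : List A) a f → ∑ xs (λ x → f x * a) ≈ ∑ xs f * a
  ∑-*ʳ []       a f = ≈-sym (zeroˡ a)
  ∑-*ʳ (x ∷ xs) a f = ≈-trans (+-congˡ (∑-*ʳ xs a f)) (≈-sym (distribʳ a (f x) _))

  ∑-swap : ∀ (xs : List A) (ys : List B) (f : A → B → Carrier) →
    ∑ xs (λ x → ∑ ys (λ y → f x y)) ≈ ∑ ys (λ y → ∑ xs (λ x → f x y))
  ∑-swap []       ys f = ≈-sym (∑-zero ys (λ _ → ≈-refl))
  ∑-swap (x ∷ xs) ys f = ≈-trans (+-congˡ (∑-swap xs ys f)) (≈-sym (∑-+ ys (f x) _))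

  ∑-filter : ∀ {p} {P : Pred A p} (P? : Decidable P) xs f →
    ∑ (filter P? xs) f ≈ ∑ xs (λ x → if does (P? x) then f x else 0#)
  ∑-filter P? []       f = ≈-refl
  ∑-filter P? (x ∷ xs) f with does (P? x)
  ... | true  = +-congˡ (∑-filter P? xs f)
  ... | false = ≈-trans (∑-filter P? xs f) (≈-sym (+-identityˡ _))

  ∑-single : ∀ {xs : List A} → Unique xs → ∀ {x} → x ∈ xs → ∀ f →
    (∀ {y} → y ∈ xs → y ≢ x → f y ≈ 0#) → ∑ xs f ≈ f x
  ∑-single {xs = y ∷ ys} (y∉ ∷ _) (here refl) f e =
    ≈-trans (+-congˡ (∑-zero ys λ m → e (there m) (λ { refl → All.lookup y∉ m refl }))) (+-identityʳ _)
  ∑-single {xs = y ∷ ys} (y∉ ∷ u) (there m) f e =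
    ≈-trans (+-cong (e (here refl) (All.lookup y∉ m)) (∑-single u m f (λ m′ → e (there m′)))) (+-identityˡ _)

  -- The induction step for triangular systems: once all other unknowns agree, equality of the two
  -- sums forces agreement in the remaining one.
  ∑-cancel : ∀ {xs : List A} → Unique xs → ∀ {x} → x ∈ xs → ∀ f g →
    (∀ {y} → y ∈ xs → y ≢ x → f y ≈ g y) → ∑ xs f ≈ ∑ xs g → f x ≈ g x
  ∑-cancel {xs = y ∷ ys} (y∉ ∷ _) (here refl) f g e s =
    +-cancelʳ _ _ _ (≈-trans s (+-congˡ (∑-cong ys λ m →
      ≈-sym (e (there m) (λ { refl → All.lookup y∉ m refl })))))
  ∑-cancel {xs = y ∷ ys} (y∉ ∷ u) (there m) f g e s =
    ∑-cancel u m f g (λ m′ → e (there m′))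
      (+-cancelˡ _ _ _ (≈-trans s (+-congʳ (≈-sym (e (here refl) (All.lookup y∉ m))))))

  ∑-assoc : ∀ (xs : List A) (ys : List B) (u : A → Carrier) (M : A → B → Carrier) (v : B → Carrier) →
    ∑ xs (λ x → u x * ∑ ys (λ y → M x y * v y)) ≈ ∑ ys (λ y → ∑ xs (λ x → u x * M x y) * v y)
  ∑-assoc xs ys u M v = begin
    ∑ xs (λ x → u x * ∑ ys (λ y → M x y * v y))
      ≈⟨ ∑-cong xs (λ {x} _ → ∑-*ˡ ys (u x) _) ⟨
    ∑ xs (λ x → ∑ ys (λ y → u x * (M x y * v y)))
      ≈⟨ ∑-swap xs ys (λ x y → u x * (M x y * v y)) ⟩
    ∑ ys (λ y → ∑ xs (λ x → u x * (M x y * v y)))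
      ≈⟨ ∑-cong ys (λ {y} _ → ≈-trans (∑-cong xs λ {x} _ → ≈-sym (*-assoc (u x) (M x y) (v y))) (∑-*ʳ xs (v y) _)) ⟩
    ∑ ys (λ y → ∑ xs (λ x → u x * M x y) * v y) ∎

  -- Evaluate g M h both ways.
  ∑-transpose : ∀ (xs : List A) (M : A → A → Carrier) g h c →
    (∀ {x} → x ∈ xs → ∑ xs (λ y → M x y * h y) ≈ c) →
    (∀ {y} → y ∈ xs → ∑ xs (λ x → M x y * g x) ≈ c) →
    c * ∑ xs g ≈ c * ∑ xs h
  ∑-transpose xs M g h c Mh gM = begin
    c * ∑ xs g
      ≈⟨ *-comm c _ ⟩
    ∑ xs g * c
      ≈⟨ ∑-*ʳ xs c g ⟨
    ∑ xs (λ x → g x * c)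
      ≈⟨ ∑-cong xs (λ m → *-congˡ (Mh m)) ⟨
    ∑ xs (λ x → g x * ∑ xs (λ y → M x y * h y))
      ≈⟨ ∑-assoc xs xs g M h ⟩
    ∑ xs (λ y → ∑ xs (λ x → g x * M x y) * h y)
      ≈⟨ ∑-cong xs (λ m → *-congʳ (≈-trans (∑-cong xs λ _ → *-comm _ _) (gM m))) ⟩
    ∑ xs (λ y → c * h y)
      ≈⟨ ∑-*ˡ xs c h ⟩
    c * ∑ xs h ∎

module ∑ℤ = Sum ℤₚ.+-*-commutativeRing
open Sum polyRing

-- Chow polynomials of bounded posets

module _ {A : Set} {p q} {P : Pred A p} {Q : Pred A q} (P? : Decidable P) (Q? : Decidable Q) where

  length-filter-mono-≤ : (∀ {x} → P x → Q x) → ∀ xs →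
    length (filter P? xs) ℕ.≤ length (filter Q? xs)
  length-filter-mono-≤ P⊆Q []       = z≤n
  length-filter-mono-≤ P⊆Q (x ∷ xs) with P? x | Q? x
  ... | yes _ | yes _ = s≤s (length-filter-mono-≤ P⊆Q xs)
  ... | yes p | no ¬q = contradiction (P⊆Q p) ¬q
  ... | no _  | yes _ = ℕₚ.m≤n⇒m≤1+n (length-filter-mono-≤ P⊆Q xs)
  ... | no _  | no _  = length-filter-mono-≤ P⊆Q xs

  -- Gives the strict decrease of the counting measures on which the inductions along the order
  -- rest: `y` is counted on one side only.
  length-filter-mono-< : (∀ {x} → P x → Q x) → ∀ {xs y} → y ∈ xs → ¬ P y → Q y →
    length (filter P? xs) ℕ.< length (filter Q? xs)
  length-filter-mono-< P⊆Q {x ∷ xs} (here refl) ¬p q with P? x | Q? x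
  ... | yes p | _     = contradiction p ¬p
  ... | no _  | yes _ = s≤s (length-filter-mono-≤ P⊆Q xs)
  ... | no _  | no ¬q = contradiction q ¬q
  length-filter-mono-< P⊆Q {x ∷ xs} (there m) ¬p q with P? x | Q? x
  ... | yes _ | yes _ = s≤s (length-filter-mono-< P⊆Q m ¬p q)
  ... | yes p | no ¬q = contradiction (P⊆Q p) ¬q
  ... | no _  | yes _ = ℕₚ.m≤n⇒m≤1+n (length-filter-mono-< P⊆Q m ¬p q)
  ... | no _  | no _  = length-filter-mono-< P⊆Q m ¬p q

-- Unlike IsBoundedGraded, this only constrains the listed elements, so that it
-- also applies to σ P and τ P, which keep the carrier of P.
record IsBounded (P : RankedPoset) : Set where
  open RankedPoset P
  field
    unique : Unique elems
    isPO   : IsPartialOrder _≡_ _≤_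
    bot∈   : bot ∈ elems
    top∈   : top ∈ elems
    bot-≤  : ∀ {x} → x ∈ elems → bot ≤ x
    ≤-top  : ∀ {x} → x ∈ elems → x ≤ top
    ρ-bot  : ρ bot ≡ 0


module Bounded {P : RankedPoset} (bounded : IsBounded P) where
  open RankedPoset P
  open IsBounded bounded
  private
    module PO = IsPartialOrder isPO

    E : List Carrier
    E = elems

  infix 4 _≟_
  abstract
    -- Only the order is given as decidable, so equality is decided by antisymmetry. Being abstract,
    -- `x ≟ y` does not unfold into the order tests that other `with` clauses abstract.
    _≟_ : ∀ (x y : Carrier) → Dec (x ≡ y)
    x ≟ y with x ≤? y | y ≤? x
    ... | yes p | yes q = yes (PO.antisym p q)
    ... | no ¬p | _     = no λ { refl → ¬p PO.refl }
    ... | yes _ | no ¬q = no λ { refl → ¬q PO.refl }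

  ≤∧≢⇒≱ : ∀ {x y} → x ≤ y → x ≢ y → ¬ y ≤ x
  ≤∧≢⇒≱ p x≢y q = x≢y (PO.antisym p q)

  lt?-sound : ∀ x y → T (lt? x y) → x ≤ y × ¬ y ≤ x
  lt?-sound x y l with x ≤? y | y ≤? x
  ... | yes p | no ¬q = p , ¬q

  -- Sizes of principal ideals and filters. The Möbius recursion lowers `#↓` of its second argument
  -- and the Chow recursion lowers `#↑` of its first; both are at most `fuel P`, so the fuel never
  -- runs out.
  #↓ #↑ : Carrier → ℕ
  #↓ y = length (filter (_≤? y) E)
  #↑ x = length (filter (x ≤?_) E)

  #↓-pos : ∀ {y} → y ∈ E → 0 ℕ.< #↓ y
  #↓-pos y∈ = ∈-length (∈-filter⁺ (_≤? _) y∈ PO.refl)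

  #↑-pos : ∀ {x} → x ∈ E → 0 ℕ.< #↑ x
  #↑-pos x∈ = ∈-length (∈-filter⁺ (_ ≤?_) x∈ PO.refl)

  #↓-mono : ∀ {x y} → y ∈ E → x ≤ y → ¬ y ≤ x → #↓ x ℕ.< #↓ y
  #↓-mono y∈ p ¬q = length-filter-mono-< (_≤? _) (_≤? _) (λ r → PO.trans r p) y∈ ¬q PO.refl

  #↑-mono : ∀ {x y} → x ∈ E → x ≤ y → ¬ y ≤ x → #↑ y ℕ.< #↑ x
  #↑-mono x∈ p ¬q = length-filter-mono-< (_ ≤?_) (_ ≤?_) (PO.trans p) x∈ ¬q PO.refl

  -- The Möbius function

  möbiusF-stable : ∀ n x {y} → y ∈ E → #↓ y ℕ.≤ n → möbiusF P n x y ≡ möbiusF P (suc n) x y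
  möbiusF-stable zero    x y∈ b = contradiction (#↓-pos y∈) (ℕₚ.≤⇒≯ b)
  möbiusF-stable (suc n) x {y} y∈ b with does (x ≤? y) | does (y ≤? x)
  ... | false | _     = refl
  ... | true  | true  = refl
  ... | true  | false = cong -_ (∑ℤ.∑-cong (filter (x ≤?_) (filter (λ z → T? (lt? z y)) E)) λ {z} z∈ →
    let z∈′ , z<y = ∈-filter⁻ (λ z → T? (lt? z y)) (proj₁ (∈-filter⁻ (x ≤?_) z∈))
        z≤y , y≰z = lt?-sound z y z<y
    in möbiusF-stable n x z∈′ (ℕₚ.≤-pred (ℕₚ.≤-trans (#↓-mono y∈ z≤y y≰z) b)))

  -- The fuel already suffices, so one more unit changes nothing; its `suc` exposes one step of the
  -- recursion.
  möbius-unfold : ∀ x {y} → y ∈ E → möbius P x y ≡ möbiusF P (suc (fuel P)) x y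
  möbius-unfold x y∈ = möbiusF-stable (fuel P) x y∈ (length-filter (_≤? _) E)

  möbius-≰ : ∀ {x y} → ¬ x ≤ y → möbius P x y ≡ + 0
  möbius-≰ {x} {y} x≰y = go (fuel P)
    where
    go : ∀ n → möbiusF P n x y ≡ + 0
    go zero = refl
    go (suc n) with x ≤? y
    ... | yes x≤y = contradiction x≤y x≰y
    ... | no  _   = refl

  möbius-refl : ∀ {x} → x ∈ E → möbius P x x ≡ + 1
  möbius-refl {x} x∈ = trans (möbius-unfold x x∈) unfolded
    where
    unfolded : möbiusF P (suc (fuel P)) x x ≡ + 1
    unfolded with x ≤? x
    ... | yes _   = refl
    ... | no  x≰x = contradiction PO.refl x≰x

  möbius-rec : ∀ {x y} → y ∈ E → x ≤ y → ¬ y ≤ x →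
    möbius P x y ≡ - sumℤ (map (möbius P x) (filter (x ≤?_) (filter (λ z → T? (lt? z y)) E)))
  möbius-rec {x} {y} y∈ x≤y y≰x = trans (möbius-unfold x y∈) unfolded
    where
    unfolded : möbiusF P (suc (fuel P)) x y
      ≡ - sumℤ (map (möbius P x) (filter (x ≤?_) (filter (λ z → T? (lt? z y)) E)))
    unfolded with x ≤? y | y ≤? x
    ... | yes _ | no _  = refl
    ... | no ¬p | _     = contradiction x≤y ¬p
    ... | yes _ | yes q = contradiction q y≰x

  δ : Carrier → Carrier → ℤ
  δ x y = if does (x ≟ y) then + 1 else + 0

  δ-≢ : ∀ {x y} → x ≢ y → δ x y ≡ + 0
  δ-≢ {x} {y} x≢y with x ≟ y
  ... | yes p = contradiction p x≢y
  ... | no _  = refl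

  -- The summand of the matrix product μ ζ. A test for x ≤ z would be redundant by `möbius-≰`.
  μζ : Carrier → Carrier → Carrier → ℤ
  μζ x y z = if le? z y then möbius P x z else + 0

  -- For x < y, `möbius-rec` makes the term at z = y the negative of all terms strictly below y, so
  -- isolating that term lets the sum cancel. In the other cases `möbius-≰` removes everything but a
  -- possible diagonal term.
  ∑-möbius : ∀ {x y} → x ∈ E → y ∈ E → ∑ℤ.∑ E (μζ x y) ≡ δ x y
  ∑-möbius {x} {y} x∈ y∈ with x ≟ y | x ≤? y
  ... | yes refl | _ = trans (∑ℤ.∑-single unique x∈ (μζ x x) off) diag
    where
    diag : μζ x x x ≡ + 1
    diag with x ≤? x
    ... | yes _   = möbius-refl x∈
    ... | no  x≰x = contradiction PO.refl x≰x
    off : ∀ {z} → z ∈ E → z ≢ x → μζ x x z ≡ + 0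
    off {z} _ z≢x with z ≤? x
    ... | yes z≤x = möbius-≰ (≤∧≢⇒≱ z≤x z≢x)
    ... | no  _   = refl
  ... | no _ | no x≰y = ∑ℤ.∑-zero E off
    where
    off : ∀ {z} → z ∈ E → μζ x y z ≡ + 0
    off {z} _ with z ≤? y
    ... | yes z≤y = möbius-≰ (λ x≤z → x≰y (PO.trans x≤z z≤y))
    ... | no  _   = refl
  ... | no x≢y | yes x≤y = begin
    ∑ℤ.∑ E (μζ x y)                       ≡⟨ ∑ℤ.∑-cong E split ⟩
    ∑ℤ.∑ E (λ z → below z ℤ.+ at z)       ≡⟨ ∑ℤ.∑-+ E below at ⟩
    ∑ℤ.∑ E below ℤ.+ ∑ℤ.∑ E at            ≡⟨ cong₂ ℤ._+_ (sym filtered) (∑ℤ.∑-single unique y∈ at at-off) ⟩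
    S ℤ.+ at y                            ≡⟨ cong (λ u → S ℤ.+ u) (trans at-y (möbius-rec y∈ x≤y (≤∧≢⇒≱ x≤y x≢y))) ⟩
    S ℤ.+ - S                             ≡⟨ ℤₚ.+-inverseʳ S ⟩
    + 0                                   ∎
    where
    open ≡-Reasoning
    S : ℤ
    S = sumℤ (map (möbius P x) (filter (x ≤?_) (filter (λ z → T? (lt? z y)) E)))
    below at : Carrier → ℤ
    below z = if lt? z y then (if le? x z then möbius P x z else + 0) else + 0
    at z = if does (z ≟ y) then möbius P x y else + 0
    filtered : S ≡ ∑ℤ.∑ E below
    filtered = trans (∑ℤ.∑-filter (x ≤?_) (filter (λ z → T? (lt? z y)) E) (möbius P x))
                     (∑ℤ.∑-filter (λ z → T? (lt? z y)) E _)
    at-y : at y ≡ möbius P x y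
    at-y with y ≟ y
    ... | yes _ = refl
    ... | no ¬p = contradiction refl ¬p
    at-off : ∀ {z} → z ∈ E → z ≢ y → at z ≡ + 0
    at-off {z} _ z≢y with z ≟ y
    ... | yes p = contradiction p z≢y
    ... | no _  = refl
    split : ∀ {z} → z ∈ E → μζ x y z ≡ below z ℤ.+ at z
    split {z} _ with z ≟ y
    ... | yes refl with z ≤? z
    ...   | yes _ = sym (ℤₚ.+-identityˡ _)
    ...   | no ¬p = contradiction PO.refl ¬p
    split {z} _ | no z≢y with z ≤? y | y ≤? z
    ...   | no _    | _       = refl
    ...   | yes z≤y | yes y≤z = contradiction (PO.antisym z≤y y≤z) z≢y
    ...   | yes z≤y | no _ with x ≤? z
    ...     | yes _   = sym (ℤₚ.+-identityʳ _)
    ...     | no  x≰z = möbius-≰ x≰z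

  -- The kernel B and the vector h

  chow↑ : Carrier → Poly
  chow↑ x = chowInterval P x top

  -- `tζ` is the matrix T, not the multiple t ζ. `χ̂` extends χ̄ by zero to pairs with x ≰ y, so
  -- that every matrix product is a sum over all of `elems`.
  μ tζ B χ̂ : Carrier → Carrier → Poly
  μ x y = constP (möbius P x y)
  tζ x y = if le? x y then tpow (ρ y ∸ ρ x) else []
  B x y = if le? x y then tpow (ρ y ∸ ρ x) +ₚ negP t else []
  χ̂ x y = if le? x y then charPolyBar P x y else []

  charPoly-∑ : ∀ x y → charPoly P x y ≋ ∑ E (λ z → μ x z *ₚ tζ z y)
  charPoly-∑ x y = ≋-trans (∑-filter (x ≤?_) (filter (_≤? y) E) _)
    (≋-trans (∑-filter (_≤? y) E _) (∑-cong E (λ {z} _ → term z)))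
    where
    term : ∀ z →
      (if le? z y then (if le? x z then scale (möbius P x z) (tpow (ρ y ∸ ρ z)) else []) else [])
      ≋ μ x z *ₚ tζ z y
    term z with z ≤? y
    ... | no _ = ≋-sym (*ₚ-zeroʳ (μ x z))
    ... | yes _ with x ≤? z
    ...   | yes _   = ≋-sym (constP-* (möbius P x z) _)
    ...   | no  x≰z rewrite möbius-≰ x≰z = ≋-sym (constP0-* (tpow (ρ y ∸ ρ z)))

  -- Every power of t takes the value 1 at t = 1. Together with `∑-möbius` this gives χ(1) = 0 for x
  -- < y, the condition for exact division by t - 1.
  sumℤ-charPoly : ∀ x y → sumℤ (charPoly P x y) ≡ ∑ℤ.∑ E (μζ x y)
  sumℤ-charPoly x y = trans (sumℤ-sumP _ (filter (x ≤?_) (filter (_≤? y) E)))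
    (trans (∑ℤ.∑-cong (filter (x ≤?_) (filter (_≤? y) E))
              (λ {z} _ → sumℤ-scale-tpow (möbius P x z) (ρ y ∸ ρ z)))
      (trans (∑ℤ.∑-filter (x ≤?_) (filter (_≤? y) E) (möbius P x))
        (trans (∑ℤ.∑-filter (_≤? y) E _) (∑ℤ.∑-cong E (λ {z} _ → term z)))))
    where
    term : ∀ z → (if le? z y then (if le? x z then möbius P x z else + 0) else + 0) ≡ μζ x y z
    term z with z ≤? y | x ≤? z
    ... | no _  | _       = refl
    ... | yes _ | yes _   = refl
    ... | yes _ | no  x≰z = sym (möbius-≰ x≰z)

  charPoly-refl : ∀ {x} → x ∈ E → charPoly P x x ≋ 1ₚ
  charPoly-refl {x} x∈ = ≋-trans (charPoly-∑ x x)
    (≋-trans (∑-single unique x∈ (λ z → μ x z *ₚ tζ z x) off) diag)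
    where
    diag : μ x x *ₚ tζ x x ≋ 1ₚ
    diag rewrite möbius-refl x∈ with x ≤? x
    ... | no  x≰x = contradiction PO.refl x≰x
    ... | yes _ rewrite ℕₚ.n∸n≡0 (ρ x) = *ₚ-identityˡ 1ₚ
    off : ∀ {z} → z ∈ E → z ≢ x → μ x z *ₚ tζ z x ≋ []
    off {z} _ z≢x with z ≤? x
    ... | no  _   = *ₚ-zeroʳ (μ x z)
    ... | yes z≤x rewrite möbius-≰ (≤∧≢⇒≱ z≤x z≢x) = constP0-* (tpow (ρ x ∸ ρ z))

  charPoly-≰ : ∀ {x y} → ¬ x ≤ y → charPoly P x y ≋ []
  charPoly-≰ {x} {y} x≰y = ≋-trans (charPoly-∑ x y) (∑-zero E (λ {z} _ → off z))
    where
    off : ∀ z → μ x z *ₚ tζ z y ≋ []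
    off z with z ≤? y
    ... | no  _   = *ₚ-zeroʳ (μ x z)
    ... | yes z≤y rewrite möbius-≰ (λ x≤z → x≰y (PO.trans x≤z z≤y)) = constP0-* (tpow (ρ y ∸ ρ z))

  -- Uses μ T = χ and μ ζ = δ. For x < y exact division turns χ into (t - 1) χ̄; on the diagonal 1 -
  -- t is (t - 1) times the conventional value -1.
  μB : ∀ {x y} → x ∈ E → y ∈ E → ∑ E (λ z → μ x z *ₚ B z y) ≋ negP (1-t *ₚ χ̂ x y)
  μB {x} {y} x∈ y∈ = ≋-trans expand value
    where
    *-constP0 : negP t *ₚ constP (+ 0) ≋ []
    *-constP0 = ≋-trans (*ₚ-congˡ (negP t) constP0) (*ₚ-zeroʳ (negP t))

    term : ∀ z → μ x z *ₚ B z y ≋ μ x z *ₚ tζ z y +ₚ negP t *ₚ constP (μζ x y z)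
    term z with z ≤? y
    ... | yes _ = solve 3 (λ m u v → m :* (u :+ :- v) := m :* u :+ :- v :* m) ≋-refl
                    (μ x z) (tpow (ρ y ∸ ρ z)) t
      where open PolySolver
    ... | no _  = ≋-sym (≋-trans (+ₚ-congˡ (μ x z *ₚ []) *-constP0) (+ₚ-identityʳ _))

    expand : ∑ E (λ z → μ x z *ₚ B z y) ≋ charPoly P x y +ₚ negP t *ₚ constP (δ x y)
    expand = ≋-trans (∑-cong E (λ {z} _ → term z))
      (≋-trans (∑-+ E (λ z → μ x z *ₚ tζ z y) (λ z → negP t *ₚ constP (μζ x y z)))
        (+ₚ-cong (≋-sym (charPoly-∑ x y))
          (≋-trans (∑-*ˡ E (negP t) (λ z → constP (μζ x y z)))
            (*ₚ-congˡ (negP t) (≋-trans (≋-sym (constP-sumℤ (μζ x y) E))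
              (constP-cong (∑-möbius x∈ y∈)))))))

    value : charPoly P x y +ₚ negP t *ₚ constP (δ x y) ≋ negP (1-t *ₚ χ̂ x y)
    value with x ≟ y
    value | yes refl with x ≤? x
    ... | no x≰x = contradiction PO.refl x≰x
    ... | yes _  = ≋-trans (+ₚ-cong (charPoly-refl x∈) (≋-refl {negP t *ₚ 1ₚ}))
      (solve 1 (λ v → con (+ 1) :+ :- v :* con (+ 1) := :- ((con (+ 1) :+ :- v) :* con (- (+ 1)))) ≋-refl t)
      where open PolySolver
    value | no x≢y with x ≤? y
    ... | no x≰y = ≋-trans (+ₚ-cong (charPoly-≰ x≰y) *-constP0) (≋-sym (negP-cong (*ₚ-zeroʳ 1-t)))
    ... | yes x≤y with y ≤? x
    ...   | yes y≤x = contradiction y≤x (≤∧≢⇒≱ x≤y x≢y)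
    ...   | no _ = ≋-trans
      (solve 2 (λ c v → c :+ :- v :* con (+ 0) := :- (:- c)) ≋-refl (charPoly P x y) t)
      (negP-cong (≋-sym (divT-1-exact (charPoly P x y)
        (trans (sumℤ-charPoly x y) (trans (∑-möbius x∈ y∈) (δ-≢ x≢y))))))
      where open PolySolver

  chowF-stable : ∀ n {x} y → x ∈ E → #↑ x ℕ.≤ n → chowF P n x y ≋ chowF P (suc n) x y
  chowF-stable zero    y x∈ b = contradiction (#↑-pos x∈) (ℕₚ.≤⇒≯ b)
  chowF-stable (suc n) {x} y x∈ b with le? y x
  ... | true  = ≋-refl
  ... | false = ∑-cong (filter (λ z → T? (lt? x z)) (filter (_≤? y) E)) λ {z} z∈ →
    let z∈′ , x<z = ∈-filter⁻ (λ z → T? (lt? x z)) z∈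
        x≤z , z≰x = lt?-sound x z x<z
    in *ₚ-congˡ (charPolyBar P x z) (chowF-stable n y (proj₁ (∈-filter⁻ (_≤? y) z∈′))
         (ℕₚ.≤-pred (ℕₚ.≤-trans (#↑-mono x∈ x≤z z≰x) b)))

  chow↑-unfold : ∀ {x} → x ∈ E → chow↑ x ≋ chowF P (suc (fuel P)) x top
  chow↑-unfold x∈ = chowF-stable (fuel P) top x∈ (length-filter (_ ≤?_) E)

  -- Below `top`, the terms with z > x form the Chow recursion and add up to h(x), while the
  -- diagonal value -1 contributes -h(x). At `top` only the diagonal term is left.
  χ̂-chow↑ : ∀ {x} → x ∈ E → ∑ E (λ z → χ̂ x z *ₚ chow↑ z) ≋ negP (constP (δ x top))
  χ̂-chow↑ {x} x∈ with x ≟ top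
  ... | yes refl = ≋-trans (∑-single unique x∈ (λ z → χ̂ x z *ₚ chow↑ z) off)
                     (≋-trans (*ₚ-congˡ (χ̂ x x) (chow↑-unfold x∈)) diag)
    where
    off : ∀ {z} → z ∈ E → z ≢ top → χ̂ top z *ₚ chow↑ z ≋ []
    off {z} z∈ z≢ with top ≤? z
    ... | yes p = contradiction p (≤∧≢⇒≱ (≤-top z∈) z≢)
    ... | no  _ = ≋-refl
    diag : χ̂ top top *ₚ chowF P (suc (fuel P)) top top ≋ constP (- (+ 1))
    diag with top ≤? top
    ... | yes _ = ≋-refl
    ... | no ¬p = contradiction PO.refl ¬p
  ... | no x≢top = begin
    ∑ E (λ z → χ̂ x z *ₚ chow↑ z)       ≈⟨ ∑-cong E split ⟩
    ∑ E (λ z → above z +ₚ at z)        ≈⟨ ∑-+ E above at ⟩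
    ∑ E above +ₚ ∑ E at                ≈⟨ +ₚ-cong filtered (∑-single unique x∈ at at-off) ⟩
    chow↑ x +ₚ at x                    ≈⟨ +ₚ-congˡ (chow↑ x) at-x ⟩
    chow↑ x +ₚ negP (chow↑ x)          ≈⟨ negP-inverseʳ (chow↑ x) ⟩
    []                                 ≈⟨ constP0 ⟨
    negP (constP (+ 0))                ∎
    where
    open SetoidReasoning (CommutativeRing.setoid polyRing)
    above at : Carrier → Poly
    above z = if le? z top then (if lt? x z then charPolyBar P x z *ₚ chow↑ z else []) else []
    at z = if does (z ≟ x) then negP (chow↑ x) else []
    unfolded : chowF P (suc (fuel P)) x top
      ≋ ∑ (filter (λ z → T? (lt? x z)) (filter (_≤? top) E)) (λ z → charPolyBar P x z *ₚ chow↑ z)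
    unfolded with top ≤? x
    ... | yes p = contradiction p (≤∧≢⇒≱ (≤-top x∈) x≢top)
    ... | no _  = ≋-refl
    filtered : ∑ E above ≋ chow↑ x
    filtered = ≋-sym (≋-trans (chow↑-unfold x∈) (≋-trans unfolded
      (≋-trans (∑-filter (λ z → T? (lt? x z)) (filter (_≤? top) E) _) (∑-filter (_≤? top) E _))))
    at-x : at x ≋ negP (chow↑ x)
    at-x with x ≟ x
    ... | yes _ = ≋-refl
    ... | no ¬p = contradiction refl ¬p
    at-off : ∀ {z} → z ∈ E → z ≢ x → at z ≋ []
    at-off {z} _ z≢x with z ≟ x
    ... | yes p = contradiction p z≢x
    ... | no _  = ≋-refl
    split : ∀ {z} → z ∈ E → χ̂ x z *ₚ chow↑ z ≋ above z +ₚ at z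
    split {z} z∈ with z ≤? top
    ... | no z≰top = contradiction (≤-top z∈) z≰top
    ... | yes _ with z ≟ x
    ...   | yes refl with z ≤? z
    ...     | yes _ = ≋-trans (constP-* (- (+ 1)) (chow↑ z))
                        (mk≋ λ k → trans (coeff-scale (- (+ 1)) (chow↑ z) k)
                          (trans (ℤₚ.-1*i≡-i (coeff (chow↑ z) k)) (sym (coeff-neg (chow↑ z) k))))
    ...     | no ¬p = contradiction PO.refl ¬p
    split {z} z∈ | yes _ | no z≢x with x ≤? z | z ≤? x
    ...     | no _    | _       = ≋-refl
    ...     | yes x≤z | yes z≤x = contradiction (PO.antisym z≤x x≤z) z≢x
    ...     | yes x≤z | no _    = ≋-sym (+ₚ-identityʳ _)

  -- μ is unitriangular, hence injective on vectors: the entries are compared from the maximal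
  -- elements downwards.
  μ-cancel : ∀ (u v : Carrier → Poly) →
    (∀ {x} → x ∈ E → ∑ E (λ z → μ x z *ₚ u z) ≋ ∑ E (λ z → μ x z *ₚ v z)) →
    ∀ {x} → x ∈ E → u x ≋ v x
  μ-cancel u v e x∈ = go _ x∈ ℕₚ.≤-refl
    where
    go : ∀ n {x} → x ∈ E → #↑ x ℕ.≤ n → u x ≋ v x
    go zero    x∈ b = contradiction (#↑-pos x∈) (ℕₚ.≤⇒≯ b)
    go (suc n) {x} x∈ b = ≋-trans (≋-sym (μ-diag (u x))) (≋-trans
      (∑-cancel unique x∈ (λ z → μ x z *ₚ u z) (λ z → μ x z *ₚ v z) off (e x∈)) (μ-diag (v x)))
      where
      μ-diag : ∀ p → μ x x *ₚ p ≋ p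
      μ-diag p rewrite möbius-refl x∈ = *ₚ-identityˡ p
      off : ∀ {z} → z ∈ E → z ≢ x → μ x z *ₚ u z ≋ μ x z *ₚ v z
      off {z} z∈ z≢x with x ≤? z
      ... | yes x≤z = *ₚ-congˡ (μ x z) (go n z∈
            (ℕₚ.≤-pred (ℕₚ.≤-trans (#↑-mono x∈ x≤z (λ z≤x → z≢x (PO.antisym z≤x x≤z))) b)))
      ... | no  x≰z rewrite möbius-≰ x≰z = ≋-trans (constP0-* (u z)) (≋-sym (constP0-* (v z)))

  -- Multiply by μ: the left-hand side becomes (t - 1) χ̄ H = (1 - t) δ.
  B-chow↑ : ∀ {x} → x ∈ E → ∑ E (λ z → B x z *ₚ chow↑ z) ≋ 1-t
  B-chow↑ = μ-cancel (λ x → ∑ E (λ z → B x z *ₚ chow↑ z)) (λ _ → 1-t) λ {x} x∈ → begin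
    ∑ E (λ z → μ x z *ₚ ∑ E (λ w → B z w *ₚ chow↑ w))
      ≈⟨ ∑-assoc E E (μ x) B chow↑ ⟩
    ∑ E (λ w → ∑ E (λ z → μ x z *ₚ B z w) *ₚ chow↑ w)
      ≈⟨ ∑-cong E (λ {w} w∈ → ≋-trans (*ₚ-congʳ (chow↑ w) (μB x∈ w∈))
           (solve 3 (λ a b c → :- (a :* b) :* c := :- a :* (b :* c)) ≋-refl 1-t (χ̂ x w) (chow↑ w))) ⟩
    ∑ E (λ w → negP 1-t *ₚ (χ̂ x w *ₚ chow↑ w))
      ≈⟨ ∑-*ˡ E (negP 1-t) (λ w → χ̂ x w *ₚ chow↑ w) ⟩
    negP 1-t *ₚ ∑ E (λ w → χ̂ x w *ₚ chow↑ w)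
      ≈⟨ *ₚ-congˡ (negP 1-t) (χ̂-chow↑ x∈) ⟩
    negP 1-t *ₚ negP (constP (δ x top))
      ≈⟨ solve 2 (λ a b → :- a :* :- b := b :* a) ≋-refl 1-t (constP (δ x top)) ⟩
    constP (δ x top) *ₚ 1-t
      -- `∑-möbius` read backwards: δ(·, 1̂) = μ 𝟙, since every listed element lies below `top`.
      ≈⟨ *ₚ-congʳ 1-t (constP-cong (∑-möbius x∈ top∈)) ⟨
    constP (∑ℤ.∑ E (μζ x top)) *ₚ 1-t
      ≈⟨ *ₚ-congʳ 1-t (constP-sumℤ (μζ x top) E) ⟩
    ∑ E (λ z → constP (μζ x top z)) *ₚ 1-t
      ≈⟨ *ₚ-congʳ 1-t (∑-cong E (λ {z} z∈ → constP-cong (drop-≤top x z∈))) ⟩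
    ∑ E (μ x) *ₚ 1-t
      ≈⟨ ∑-*ʳ E 1-t (μ x) ⟨
    ∑ E (λ z → μ x z *ₚ 1-t) ∎
    where
    open SetoidReasoning (CommutativeRing.setoid polyRing)
    open PolySolver
    drop-≤top : ∀ x {z} → z ∈ E → μζ x top z ≡ möbius P x z
    drop-≤top x {z} z∈ with z ≤? top
    ... | yes _ = refl
    ... | no ¬p = contradiction (≤-top z∈) ¬p

  B-≤ : ∀ {x y} → x ≤ y → B x y ≡ tpow (ρ y ∸ ρ x) +ₚ negP t
  B-≤ {x} {y} x≤y with x ≤? y
  ... | yes _   = refl
  ... | no  x≰y = contradiction x≤y x≰y

  B-≰ : ∀ {x y} → ¬ x ≤ y → B x y ≡ []
  B-≰ {x} {y} x≰y with x ≤? y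
  ... | yes x≤y = contradiction x≤y x≰y
  ... | no  _   = refl

  B-refl : ∀ x → B x x ≡ 1-t
  B-refl x = trans (B-≤ PO.refl) (cong (λ k → tpow k +ₚ negP t) (ℕₚ.n∸n≡0 (ρ x)))

  B-bot : ∀ {x} → x ∈ E → B bot x ≡ tpow (ρ x) +ₚ negP t
  B-bot {x} x∈ = trans (B-≤ (bot-≤ x∈)) (cong (λ k → tpow (ρ x ∸ k) +ₚ negP t) ρ-bot)

  -- The weight t^ρ(z) is `B bot z` plus t, and row 0̂ of the relation sums the first part to 1 - t.
  augChow-∑ : augChow P ≋ 1-t +ₚ t *ₚ ∑ E chow↑
  augChow-∑ = ≋-trans (∑-cong E term)
    (≋-trans (∑-+ E (λ z → B bot z *ₚ chow↑ z) (λ z → t *ₚ chow↑ z))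
      (+ₚ-cong (B-chow↑ bot∈) (∑-*ˡ E t chow↑)))
    where
    open PolySolver
    term : ∀ {z} → z ∈ E → tpow (ρ z) *ₚ chow↑ z ≋ B bot z *ₚ chow↑ z +ₚ t *ₚ chow↑ z
    term {z} z∈ rewrite B-bot z∈ =
      solve 3 (λ u v h → u :* h := (u :+ :- v) :* h :+ v :* h) ≋-refl (tpow (ρ z)) t (chow↑ z)

-- Truncations of graded posets

≢⇒≡ᵇ-false : ∀ {m n} → m ≢ n → (m ≡ᵇ n) ≡ false
≢⇒≡ᵇ-false {m} {n} m≢n with m ≡ᵇ n in eq
... | true  = contradiction (ℕₚ.≡ᵇ⇒≡ m n (subst T (sym eq) _)) m≢n
... | false = refl

≡ᵇ-refl : ∀ n → (n ≡ᵇ n) ≡ true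
≡ᵇ-refl zero    = refl
≡ᵇ-refl (suc n) = ≡ᵇ-refl n

[n∸m]∸[n∸o]≡o∸m : ∀ n m {o} → o ℕ.≤ n → (n ∸ m) ∸ (n ∸ o) ≡ o ∸ m
[n∸m]∸[n∸o]≡o∸m n m {o} o≤n = begin
  (n ∸ m) ∸ (n ∸ o)    ≡⟨ ℕₚ.∸-+-assoc n m (n ∸ o) ⟩
  n ∸ (m ℕ.+ (n ∸ o))  ≡⟨ cong (n ∸_) (ℕₚ.+-comm m (n ∸ o)) ⟩
  n ∸ ((n ∸ o) ℕ.+ m)  ≡⟨ ℕₚ.∸-+-assoc n (n ∸ o) m ⟨
  (n ∸ (n ∸ o)) ∸ m    ≡⟨ cong (_∸ m) (ℕₚ.m∸[m∸n]≡n o≤n) ⟩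
  o ∸ m                ∎
  where open ≡-Reasoning

module Graded {P : RankedPoset} (graded : IsBoundedGraded P) where
  open RankedPoset P
  open IsBoundedGraded graded
  private module PO = IsPartialOrder isPO

  -- `ρ-cover` speaks of covers only. Either nothing lies strictly between x and y, and they form a
  -- cover, or an intermediate z splits the interval into two with fewer elements.
  ρ-strict : ∀ {x y} → x ≤ y → x ≢ y → ρ x ℕ.< ρ y
  ρ-strict {x} {y} = go _ x y ℕₚ.≤-refl
    where
    between? : ∀ (x y : Carrier) → Decidable (λ z → x ≤ z × z ≤ y)
    between? x y z = (x ≤? z) ×-dec (z ≤? y)

    go : ∀ n x y → length (filter (between? x y) elems) ℕ.≤ n → x ≤ y → x ≢ y → ρ x ℕ.< ρ y
    go n x y b x≤y x≢y with any? (λ z → (between? x y z) ×-dec (¬? (z ≤? x) ×-dec ¬? (y ≤? z))) elems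
    go n x y b x≤y x≢y | no none = ℕₚ.≤-reflexive (sym (ρ-cover x y
      (x≤y , (λ y≤x → x≢y (PO.antisym x≤y y≤x)) , cover)))
      where
      cover : ∀ z → x ≤ z → z ≤ y → (z ≤ x) ⊎ (y ≤ z)
      cover z x≤z z≤y with z ≤? x | y ≤? z
      ... | yes p | _     = inj₁ p
      ... | no _  | yes q = inj₂ q
      ... | no ¬p | no ¬q = contradiction (lose (complete z) ((x≤z , z≤y) , ¬p , ¬q)) none
    go n x y b x≤y x≢y | yes some with find some
    go zero x y b x≤y x≢y | yes some | z , z∈ , (x≤z , z≤y) , z≰x , y≰z =
      contradiction (ℕₚ.≤-trans (length-filter-mono-< (between? x z) (between? x y)
        (λ (p , q) → p , PO.trans q z≤y) (complete y) (λ (_ , q) → y≰z q) (x≤y , PO.refl)) b) ℕₚ.n≮0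
    go (suc n) x y b x≤y x≢y | yes some | z , z∈ , (x≤z , z≤y) , z≰x , y≰z = ℕₚ.<-trans
      (go n x z (ℕₚ.≤-pred (ℕₚ.≤-trans (length-filter-mono-< (between? x z) (between? x y)
          (λ (p , q) → p , PO.trans q z≤y) (complete y) (λ (_ , q) → y≰z q) (x≤y , PO.refl)) b))
        x≤z λ { refl → z≰x PO.refl })
      (go n z y (ℕₚ.≤-pred (ℕₚ.≤-trans (length-filter-mono-< (between? z y) (between? x y)
          (λ (p , q) → PO.trans x≤z p , q) (complete x) (λ (p , _) → z≰x p) (PO.refl , x≤y)) b))
        z≤y λ { refl → y≰z PO.refl })

  bounded : IsBounded P
  bounded = record
    { unique = unique
    ; isPO   = isPO
    ; bot∈   = complete bot
    ; top∈   = complete top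
    ; bot-≤  = λ {x} _ → bot-least x
    ; ≤-top  = λ {x} _ → top-great x
    ; ρ-bot  = ρ-bot
    }

  open Bounded bounded using (_≟_)

  ρ-pos : ∀ {x} → x ≢ bot → 0 ℕ.< ρ x
  ρ-pos {x} x≢bot = subst (ℕ._< ρ x) ρ-bot (ρ-strict (bot-least x) (λ e → x≢bot (sym e)))

  ρ≤ρ-top : ∀ x → ρ x ℕ.≤ ρ top
  ρ≤ρ-top x with x ≟ top
  ... | yes refl = ℕₚ.≤-refl
  ... | no  x≢   = ℕₚ.<⇒≤ (ρ-strict (top-great x) x≢)

  -- Elements and ranks of σ(P) and τ(P*)

  Q R : RankedPoset
  Q = σ P
  R = τ (dual P)

  notAtom : Carrier → Bool
  notAtom x = not (isAtom P x)

  notAtom-true : ∀ {x} → ρ x ≢ 1 → notAtom x ≡ true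
  notAtom-true ρx≢1 = cong not (≢⇒≡ᵇ-false ρx≢1)

  ∈Q⁺ : ∀ {x} → ρ x ≢ 1 → x ∈ RP.elems Q
  ∈Q⁺ {x} ρx≢1 = ∈-filter⁺ (λ x → T? (notAtom x)) (complete x) (subst T (sym (notAtom-true ρx≢1)) _)

  ∈Q⁻ : ∀ {x} → x ∈ RP.elems Q → ρ x ≢ 1
  ∈Q⁻ {x} x∈ ρx≡1 with ρ x | ρx≡1 | proj₂ (∈-filter⁻ (λ x → T? (notAtom x)) {xs = elems} x∈)
  ... | _ | refl | ()

  -- The formula also covers the degenerate case in which 1̂ is an atom.
  ρQ-top : ρ (RP.top Q) ∸ 1 ≡ ρ top ∸ 1
  ρQ-top with isAtom P top in eq
  ... | false = refl
  ... | true rewrite ℕₚ.≡ᵇ⇒≡ (ρ top) 1 (subst T (sym eq) _) | ρ-bot = refl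

  Q-top∈ : RP.top Q ∈ RP.elems Q
  Q-top∈ with isAtom P top in eq
  ... | true  = ∈Q⁺ (λ e → contradiction (trans (sym ρ-bot) e) λ ())
  ... | false = ∈Q⁺ (λ e → contradiction (trans (sym eq) (cong (_≡ᵇ 1) e)) λ ())

  -- If 1̂ is an atom, each x ≠ 0̂ has rank exactly 1 and has been removed, so 0̂ is the greatest
  -- remaining element.
  Q-≤-top : ∀ {x} → x ∈ RP.elems Q → x ≤ RP.top Q
  Q-≤-top {x} x∈ with isAtom P top in eq
  ... | false = top-great x
  ... | true with x ≟ bot
  ...   | yes refl = PO.refl
  ...   | no x≢bot = contradiction
    (ℕₚ.≤-antisym (subst (ρ x ℕ.≤_) (ℕₚ.≡ᵇ⇒≡ (ρ top) 1 (subst T (sym eq) _)) (ρ≤ρ-top x)) (ρ-pos x≢bot))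
    (∈Q⁻ x∈)

  boundedQ : IsBounded Q
  boundedQ = record
    { unique = Uniqueₚ.filter⁺ (λ x → T? (notAtom x)) unique
    ; isPO   = isPO
    ; bot∈   = ∈Q⁺ (λ e → contradiction (trans (sym ρ-bot) e) λ ())
    ; top∈   = Q-top∈
    ; bot-≤  = λ {x} _ → bot-least x
    ; ≤-top  = Q-≤-top
    ; ρ-bot  = cong (_∸ 1) ρ-bot
    }

  coatom-dual : ∀ x → isCoatom (dual P) x ≡ isAtom P x
  coatom-dual x rewrite ρ-bot = lemma (ρ x) (ρ top) (ρ≤ρ-top x)
    where
    lemma : ∀ m n → m ℕ.≤ n → (suc (n ∸ m) ≡ᵇ n) ≡ (m ≡ᵇ 1)
    lemma zero          n             _             = ≢⇒≡ᵇ-false (ℕₚ.1+n≢n {n})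
    lemma (suc zero)    (suc n)       _             = ≡ᵇ-refl n
    lemma (suc (suc m)) (suc (suc n)) (s≤s (s≤s _)) = ≢⇒≡ᵇ-false (ℕₚ.<⇒≢ (s≤s (ℕₚ.m∸n≤m n m)))

  elems-R : RP.elems R ≡ RP.elems Q
  elems-R = filter-≐ (λ x → T? (not (isCoatom (dual P) x))) (λ x → T? (notAtom x))
    ( (λ {x} → subst (λ b → T (not b)) (coatom-dual x))
    , (λ {x} → subst (λ b → T (not b)) (sym (coatom-dual x))) ) elems

  bot-R : RP.bot R ≡ RP.top Q
  bot-R = cong (if_then bot else top) (coatom-dual top)

  -- `τ` lowers only the rank of 0̂, the greatest element of the dual, whereas `σ` lowers every rank
  -- except that of 0̂. Complementing in `ρ top ∸ 1` reconciles the two, with `ρ x ∸ 1` truncating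
  -- at 0̂.
  ρ-R : ∀ x → RP.ρ R x ≡ (ρ top ∸ 1) ∸ (ρ x ∸ 1)
  ρ-R x rewrite ρ-bot = lemma (ρ x) (ρ top) (ρ≤ρ-top x)
    where
    lemma : ∀ m n → m ℕ.≤ n →
      (if n ∸ m ≡ᵇ n then n ∸ m ∸ 1 else n ∸ m) ≡ (n ∸ 1) ∸ (m ∸ 1)
    lemma zero    n       _ rewrite ≡ᵇ-refl n = refl
    lemma (suc m) (suc n) _ rewrite ≢⇒≡ᵇ-false (ℕₚ.<⇒≢ (s≤s (ℕₚ.m∸n≤m n m))) = refl

  ∈R⇒∈Q : ∀ {x} → x ∈ RP.elems R → x ∈ RP.elems Q
  ∈R⇒∈Q {x} = subst (x ∈_) elems-R

  ∈Q⇒∈R : ∀ {x} → x ∈ RP.elems Q → x ∈ RP.elems R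
  ∈Q⇒∈R {x} = subst (x ∈_) (sym elems-R)

  boundedR : IsBounded R
  boundedR = record
    { unique = subst Unique (sym elems-R) (IsBounded.unique boundedQ)
    ; isPO   = Flip.isPartialOrder isPO
    ; bot∈   = ∈Q⇒∈R (subst (_∈ RP.elems Q) (sym bot-R) Q-top∈)
    ; top∈   = ∈Q⇒∈R (IsBounded.bot∈ boundedQ)
    ; bot-≤  = λ {x} x∈ → subst (x ≤_) (sym bot-R) (Q-≤-top (∈R⇒∈Q x∈))
    ; ≤-top  = λ {x} _ → bot-least x
    ; ρ-bot  = trans (cong (RP.ρ R) bot-R) (trans (ρ-R (RP.top Q))
                 (trans (cong (ρ top ∸ 1 ∸_) ρQ-top) (ℕₚ.n∸n≡0 (ρ top ∸ 1))))
    }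

  -- Duality between σ(P) and τ(P*)

  private
    module MP = Bounded bounded
    module MQ = Bounded boundedQ
    module MR = Bounded boundedR

  -- Besides the order, `B` uses only differences of ranks, and complementing the ranks reverses
  -- these differences.
  B-R : ∀ x y → MR.B y x ≡ MQ.B x y
  B-R x y = cong (λ k → if le? x y then tpow k +ₚ negP t else [])
    (trans (cong₂ _∸_ (ρ-R x) (ρ-R y))
      ([n∸m]∸[n∸o]≡o∸m (ρ top ∸ 1) (ρ x ∸ 1) (ℕₚ.∸-monoˡ-≤ 1 (ρ≤ρ-top y))))

  ∑-chow↑-dual : ∑ (RP.elems R) MR.chow↑ ≋ ∑ (RP.elems Q) MQ.chow↑
  ∑-chow↑-dual = ≋-trans (≡⇒≋ (cong (λ xs → ∑ xs MR.chow↑) elems-R)) (1-t-cancel _ _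
    (∑-transpose (RP.elems Q) MQ.B MR.chow↑ MQ.chow↑ 1-t MQ.B-chow↑ right))
    where
    right : ∀ {y} → y ∈ RP.elems Q → ∑ (RP.elems Q) (λ x → MQ.B x y *ₚ MR.chow↑ x) ≋ 1-t
    right {y} y∈ = ≋-trans (∑-cong (RP.elems Q) λ {x} _ → *ₚ-congʳ (MR.chow↑ x) (≡⇒≋ (sym (B-R x y))))
      (subst (λ xs → ∑ xs (λ x → MR.B y x *ₚ MR.chow↑ x) ≋ 1-t) elems-R (MR.B-chow↑ (∈Q⇒∈R y∈)))

  augChow-dual : augChow Q ≋ augChow R
  augChow-dual = ≋-trans MQ.augChow-∑
    (≋-trans (+ₚ-congˡ 1-t (*ₚ-congˡ t (≋-sym ∑-chow↑-dual))) (≋-sym MR.augChow-∑))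

  -- Comparison of P with σ(P)

  B-σ : ∀ {x y} → 0 ℕ.< ρ x → x ≤ y → MQ.B x y ≡ MP.B x y
  B-σ {x} {y} 0<ρx x≤y = trans (MQ.B-≤ x≤y)
    (trans (cong (λ k → tpow k +ₚ negP t) (ranks 0<ρx)) (sym (MP.B-≤ x≤y)))
    where
    -- Away from 0̂ both ranks drop by one. At 0̂ the subtraction truncates, which is why only that
    -- row of `B` changes.
    ranks : 0 ℕ.< ρ x → (ρ y ∸ 1) ∸ (ρ x ∸ 1) ≡ ρ y ∸ ρ x
    ranks p with ρ x | p
    ... | suc k | _ = ℕₚ.∸-+-assoc (ρ y) 1 k

  -- Extends sums over `σ P` by zero to sums over `elems`, so that the relations of the two posets
  -- can be compared term by term.
  when : Bool → Poly → Poly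
  when b p = if b then p else []

  -- Above x ≠ 0̂ the posets σ P and P agree, and the relation B-chow↑
  -- determines the values of chow↑ from the top downwards.
  chow↑-σ : ∀ {x} → x ∈ RP.elems Q → x ≢ bot → MQ.chow↑ x ≋ MP.chow↑ x
  chow↑-σ = go _ ℕₚ.≤-refl
    where
    go : ∀ n {x} → MP.#↑ x ℕ.≤ n → x ∈ RP.elems Q → x ≢ bot → MQ.chow↑ x ≋ MP.chow↑ x
    go zero    {x} b x∈ x≢bot = contradiction (MP.#↑-pos (complete x)) (ℕₚ.≤⇒≯ b)
    go (suc n) {x} b x∈ x≢bot = 1-t-cancel _ _ (≋-trans (≋-sym diagQ)
      (≋-trans (∑-cancel unique (complete x) fQ fP (λ {z} _ z≢x → off z z≢x (x ≤? z)) sums) diagP))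
      where
      fQ fP : Carrier → Poly
      fQ z = when (notAtom z) (MQ.B x z *ₚ MQ.chow↑ z)
      fP z = MP.B x z *ₚ MP.chow↑ z

      sums : ∑ elems fQ ≋ ∑ elems fP
      sums = ≋-trans (≋-sym (∑-filter (λ z → T? (notAtom z)) elems _))
        (≋-trans (MQ.B-chow↑ x∈) (≋-sym (MP.B-chow↑ (complete x))))

      diagQ : fQ x ≋ 1-t *ₚ MQ.chow↑ x
      diagQ rewrite notAtom-true (∈Q⁻ x∈) | MQ.B-refl x = ≋-refl

      diagP : fP x ≋ 1-t *ₚ MP.chow↑ x
      diagP rewrite MP.B-refl x = ≋-refl

      off : ∀ z → z ≢ x → Dec (x ≤ z) → fQ z ≋ fP z
      off z z≢x (no x≰z) rewrite MQ.B-≰ x≰z | MP.B-≰ x≰z with notAtom z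
      ... | true  = ≋-refl
      ... | false = ≋-refl
      off z z≢x (yes x≤z) = ≋-trans (≡⇒≋ (cong (λ b → when b (MQ.B x z *ₚ MQ.chow↑ z)) (notAtom-true ρz≢1)))
        (≋-trans (*ₚ-congʳ (MQ.chow↑ z) (≡⇒≋ (B-σ (ρ-pos x≢bot) x≤z)))
          (*ₚ-congˡ (MP.B x z) (go n
            (ℕₚ.≤-pred (ℕₚ.≤-trans (MP.#↑-mono (complete x) x≤z (MP.≤∧≢⇒≱ x≤z x≢z)) b))
            (∈Q⁺ ρz≢1) λ { refl → x≢bot (PO.antisym x≤z (bot-least x)) })))
        where
        x≢z : x ≢ z
        x≢z e = z≢x (sym e)
        -- Strictly above x ≠ 0̂ all ranks exceed 1, so no element there has been removed.
        ρz≢1 : ρ z ≢ 1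
        ρz≢1 e = ℕₚ.<⇒≱ (subst (ρ x ℕ.<_) e (ρ-strict x≤z x≢z)) (ρ-pos x≢bot)

  -- The termwise identity is t^(k-1) - t = (t^k - t) + (1 - t) t^(k-1) with k = ρ(z) ≥ 2: row 0̂ of
  -- `B` for `σ P` exceeds the one for `P` by 1 - t times the weight of z in the augmented Chow
  -- polynomial.
  chow-σ : chow P ≋ augChow Q
  chow-σ = 1-t-cancel (chow P) (augChow Q) (+-cancelˡ 1-t (1-t *ₚ chow P) (1-t *ₚ augChow Q) (begin
    1-t +ₚ 1-t *ₚ chow P                      ≈⟨ +ₚ-cong ∑-fQ ∑-at ⟨
    ∑ elems fQ +ₚ ∑ elems at                  ≈⟨ ∑-+ elems fQ at ⟨
    ∑ elems (λ z → fQ z +ₚ at z)              ≈⟨ ∑-cong elems (λ {z} _ → term z) ⟩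
    ∑ elems (λ z → fP z +ₚ 1-t *ₚ aug z)      ≈⟨ ∑-+ elems fP (λ z → 1-t *ₚ aug z) ⟩
    ∑ elems fP +ₚ ∑ elems (λ z → 1-t *ₚ aug z) ≈⟨ +ₚ-cong (MP.B-chow↑ (complete bot)) ∑-aug ⟩
    1-t +ₚ 1-t *ₚ augChow Q                   ∎))
    where
    open SetoidReasoning (CommutativeRing.setoid polyRing)
    open RingProperties (CommutativeRing.ring polyRing) using (+-cancelˡ)
    fQ fP aug at : Carrier → Poly
    fQ z  = when (notAtom z) (MQ.B bot z *ₚ MQ.chow↑ z)
    fP z  = MP.B bot z *ₚ MP.chow↑ z
    aug z = when (notAtom z) (tpow (ρ z ∸ 1) *ₚ MQ.chow↑ z)
    -- The two posets may have different values h(0̂), so the term for `P` is added by hand, at 0̂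
    -- only.
    at z  = when (does (z ≟ bot)) (1-t *ₚ chow P)

    ∑-fQ : ∑ elems fQ ≋ 1-t
    ∑-fQ = ≋-trans (≋-sym (∑-filter (λ z → T? (notAtom z)) elems _))
                   (MQ.B-chow↑ (IsBounded.bot∈ boundedQ))

    ∑-aug : ∑ elems (λ z → 1-t *ₚ aug z) ≋ 1-t *ₚ augChow Q
    ∑-aug = ≋-trans (∑-*ˡ elems 1-t aug)
      (*ₚ-congˡ 1-t (≋-sym (∑-filter (λ z → T? (notAtom z)) elems _)))

    ∑-at : ∑ elems at ≋ 1-t *ₚ chow P
    ∑-at = ≋-trans (∑-single unique (complete bot) at at-off) at-bot
      where
      at-bot : at bot ≋ 1-t *ₚ chow P
      at-bot with bot ≟ bot
      ... | yes _ = ≋-refl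
      ... | no ¬p = contradiction refl ¬p
      at-off : ∀ {z} → z ∈ elems → z ≢ bot → at z ≋ []
      at-off {z} _ z≢ with z ≟ bot
      ... | yes p = contradiction p z≢
      ... | no _  = ≋-refl

    term : ∀ z → fQ z +ₚ at z ≋ fP z +ₚ 1-t *ₚ aug z
    term z with z ≟ bot
    -- Here `ρ bot ∸ 1` truncates to 0, so 0̂ has weight 1 and the two sides differ only in the
    -- order of their summands.
    ... | yes refl rewrite MQ.B-refl bot | MP.B-refl bot | ρ-bot =
      ≋-trans (+ₚ-comm (1-t *ₚ MQ.chow↑ bot) (1-t *ₚ chow P))
        (+ₚ-congˡ (1-t *ₚ chow P) (*ₚ-congˡ 1-t (≋-sym (*ₚ-identityˡ (MQ.chow↑ bot)))))
    ... | no z≢bot with ρ z ℕ.≟ 1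
    -- At an atom the entry of `B` in row 0̂ is t - t = 0; hence removing the atoms costs nothing.
    ...   | yes ρz≡1 rewrite MP.B-bot (complete z) | ρz≡1 =
      ≋-sym (+ₚ-cong (*ₚ-congʳ (MP.chow↑ z) (negP-inverseʳ t)) (*ₚ-zeroʳ 1-t))
    ...   | no ρz≢1 rewrite notAtom-true ρz≢1 | MP.B-bot (complete z) | MQ.B-bot (∈Q⁺ ρz≢1) =
      begin
      (u +ₚ negP t) *ₚ MQ.chow↑ z +ₚ []
        ≈⟨ +ₚ-identityʳ _ ⟩
      (u +ₚ negP t) *ₚ MQ.chow↑ z
        ≈⟨ solve 3 (λ u v h → (u :+ :- v) :* h
             := (v :* u :+ :- v) :* h :+ (con (+ 1) :+ :- v) :* (u :* h)) ≋-refl u t (MQ.chow↑ z) ⟩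
      (t *ₚ u +ₚ negP t) *ₚ MQ.chow↑ z +ₚ 1-t *ₚ (u *ₚ MQ.chow↑ z)
        ≈⟨ +ₚ-cong (≋-trans (*ₚ-congˡ (t *ₚ u +ₚ negP t) (chow↑-σ (∈Q⁺ ρz≢1) z≢bot))
             (*ₚ-congʳ (MP.chow↑ z) (+ₚ-cong (≋-sym tpow-ρ) (≋-refl {negP t}))))
             (≋-refl {1-t *ₚ (u *ₚ MQ.chow↑ z)}) ⟩
      (tpow (ρ z) +ₚ negP t) *ₚ MP.chow↑ z +ₚ 1-t *ₚ (u *ₚ MQ.chow↑ z) ∎
      where
      open PolySolver
      u : Poly
      u = tpow (ρ z ∸ 1)
      tpow-ρ : tpow (ρ z) ≋ t *ₚ u
      tpow-ρ with ρ z | ρ-pos z≢bot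
      ... | suc k | _ = tpow-suc k

theorem1p2 : (P : RankedPoset) → IsBoundedGraded P →
    (chow P ≈ₚ augChow (σ P)) × (chow P ≈ₚ augChow (τ (dual P)))
theorem1p2 P graded = coeffs chow-σ , coeffs (≋-trans chow-σ augChow-dual)
  where open Graded graded
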